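{- Let $0<q<1$, let $n,i$ be integers with $1\le i\le n$, and let $x\in[0,1]$. Then $$\frac{1}{([1-x]_q+[x]_q)^{n-i}}\sum_{k=i-1}^n\frac{\binom{k}{i}}{\binom{n}{i}}B_{k,n}(x,q)=[x]_q^i.$$
   Context: Let $q$ be a real number with $0<q<1$. For real $x$, the $q$-number is $[x]_q=\frac{1-q^x}{1-q}$. For a nonnegative integer $k$ and $x\in[0,1]$, the modified $q$-Bernstein polynomials $B_{k,n}(x,q)$, $n=0,1,2,\dots$, are defined by the generating function $$\frac{t^k e^{[1-x]_q t}[x]_q^k}{k!}=\sum_{n=0}^\infty B_{k,n}(x,q)\frac{t^n}{n!}.$$ Here $\binom{k}{i}=0$ when $k<i$. -}

module Defs where

open import Data.Nat.Base as ℕ using (ℕ; zero; suc; _∸_; _!)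
import Data.Nat.Properties as ℕₚ
open import Data.Nat.Combinatorics using (_C_; nCk+nC[k+1]≡[n+1]C[k+1])
open import Data.Integer.Base as ℤ using (+_)
import Data.Integer.Properties as ℤₚ
open import Data.Rational.Base as ℚ using (ℚ; 0ℚ; 1ℚ; ½)
import Data.Rational.Properties as ℚₚ
import Data.Rational.Unnormalised.Base as ℚᵘ
import Data.Rational.Unnormalised.Properties as ℚᵘₚ
open import Data.Rational.Solver using (module +-*-Solver)
open import Data.Product.Base using (∃; _×_; _,_; proj₁; proj₂)
open import Data.Sum.Base using (_⊎_; inj₁; inj₂)
open import Data.Bool.Base using (if_then_else_)
open import Relation.Nullary using (yes; no; contradiction)
open import Relation.Binary.PropositionalEquality using (_≡_; _≢_; refl; sym; trans; cong; cong₂; subst)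

infixr 8 _^ℚ_

_^ℚ_ : ℚ → ℕ → ℚ
p ^ℚ zero  = 1ℚ
p ^ℚ suc k = p ℚ.* p ^ℚ k

sumℚ : ℕ → (ℕ → ℚ) → ℚ
sumℚ zero    f = 0ℚ
sumℚ (suc n) f = sumℚ n f ℚ.+ f n

1/ℕ : (d : ℕ) .{{_ : ℕ.NonZero d}} → ℚ
1/ℕ d = + 1 ℚ./ d

open +-*-Solver

ι : ℕ → ℚ
ι n = + n ℚ./ 1

abstract
  ≤ˡ : ∀ {a b c : ℚ} → a ≡ b → a ℚ.≤ c → b ℚ.≤ c
  ≤ˡ refl h = h

  ≤ʳ : ∀ {a b c : ℚ} → a ≡ b → c ℚ.≤ a → c ℚ.≤ b
  ≤ʳ refl h = h

  <ˡ : ∀ {a b c : ℚ} → a ≡ b → a ℚ.< c → b ℚ.< c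
  <ˡ refl h = h

  <ʳ : ∀ {a b c : ℚ} → a ≡ b → c ℚ.< a → c ℚ.< b
  <ʳ refl h = h

  subst₂≤ : ∀ {a b c d : ℚ} → a ≡ b → c ≡ d → a ℚ.≤ c → b ℚ.≤ d
  subst₂≤ refl refl h = h

  0<1 : 0ℚ ℚ.< 1ℚ
  0<1 = ℚₚ.positive⁻¹ 1ℚ

  0≤1 : 0ℚ ℚ.≤ 1ℚ
  0≤1 = ℚₚ.<⇒≤ 0<1

  0<½ : 0ℚ ℚ.< ½
  0<½ = ℚₚ.positive⁻¹ ½

  *-pos : ∀ {a b} → 0ℚ ℚ.< a → 0ℚ ℚ.< b → 0ℚ ℚ.< a ℚ.* b
  *-pos {a} {b} p q = ℚₚ.positive⁻¹ (a ℚ.* b)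
    {{ℚₚ.pos*pos⇒pos a {{ℚ.positive p}} b {{ℚ.positive q}}}}

  *-nonneg : ∀ {a b} → 0ℚ ℚ.≤ a → 0ℚ ℚ.≤ b → 0ℚ ℚ.≤ a ℚ.* b
  *-nonneg {a} {b} p q = ℚₚ.nonNegative⁻¹ (a ℚ.* b)
    {{ℚₚ.nonNeg*nonNeg⇒nonNeg a {{ℚ.nonNegative p}} b {{ℚ.nonNegative q}}}}

  +-pos : ∀ {a b} → 0ℚ ℚ.≤ a → 0ℚ ℚ.< b → 0ℚ ℚ.< a ℚ.+ b
  +-pos {a} {b} p q = subst (ℚ._< a ℚ.+ b) (ℚₚ.+-identityˡ 0ℚ) (ℚₚ.+-mono-≤-< p q)

  *-mono : ∀ {a b c d} → 0ℚ ℚ.≤ a → a ℚ.≤ b → 0ℚ ℚ.≤ c → c ℚ.≤ d → a ℚ.* c ℚ.≤ b ℚ.* d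
  *-mono {a} {b} {c} {d} 0≤a a≤b 0≤c c≤d = ℚₚ.≤-trans
    (ℚₚ.*-monoʳ-≤-nonNeg c {{ℚ.nonNegative 0≤c}} a≤b)
    (ℚₚ.*-monoˡ-≤-nonNeg b {{ℚ.nonNegative (ℚₚ.≤-trans 0≤a a≤b)}} c≤d)

  *-monoʳ : ∀ {a c d} → 0ℚ ℚ.≤ a → c ℚ.≤ d → a ℚ.* c ℚ.≤ a ℚ.* d
  *-monoʳ {a} 0≤a = ℚₚ.*-monoˡ-≤-nonNeg a {{ℚ.nonNegative 0≤a}}

  recip : ∀ {a} → 0ℚ ℚ.< a → ∃ λ b → 0ℚ ℚ.< b × b ℚ.* a ≡ 1ℚ
  recip {a} p = (ℚ.1/ a) {{nz}} ,
    ℚₚ.positive⁻¹ ((ℚ.1/ a) {{nz}}) {{ℚₚ.1/pos⇒pos a {{ℚ.positive p}}}} ,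
    ℚₚ.*-inverseˡ a {{nz}}
    where
    nz : ℚ.NonZero a
    nz = ℚ.>-nonZero p

  p-q≤⇒ : ∀ {p q} → p ℚ.≤ q → 0ℚ ℚ.≤ q ℚ.- p
  p-q≤⇒ {p} {q} h = subst (ℚ._≤ q ℚ.- p) (ℚₚ.+-inverseʳ p) (ℚₚ.+-monoˡ-≤ (ℚ.- p) h)

  p-q<⇒ : ∀ {p q} → p ℚ.< q → 0ℚ ℚ.< q ℚ.- p
  p-q<⇒ {p} {q} h = subst (ℚ._< q ℚ.- p) (ℚₚ.+-inverseʳ p) (ℚₚ.+-monoˡ-< (ℚ.- p) h)

  ≤∣∣ : ∀ p → p ℚ.≤ ℚ.∣ p ∣
  ≤∣∣ p with ℚₚ.≤-total 0ℚ p
  ... | inj₁ h = ℚₚ.≤-reflexive (sym (ℚₚ.0≤p⇒∣p∣≡p h))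
  ... | inj₂ h = ℚₚ.≤-trans h (ℚₚ.0≤∣p∣ p)

  ∣-∣-sym : ∀ p q → ℚ.∣ p ℚ.- q ∣ ≡ ℚ.∣ q ℚ.- p ∣
  ∣-∣-sym p q = trans (sym (ℚₚ.∣-p∣≡∣p∣ (p ℚ.- q)))
    (cong ℚ.∣_∣ (solve 2 (λ a b → :- (a :- b) := b :- a) refl p q))

  triangle : ∀ a b c → ℚ.∣ a ℚ.- c ∣ ℚ.≤ ℚ.∣ a ℚ.- b ∣ ℚ.+ ℚ.∣ b ℚ.- c ∣
  triangle a b c = subst (λ t → ℚ.∣ t ∣ ℚ.≤ ℚ.∣ a ℚ.- b ∣ ℚ.+ ℚ.∣ b ℚ.- c ∣)
    (solve 3 (λ a b c → (a :- b) :+ (b :- c) := a :- c) refl a b c)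
    (ℚₚ.∣p+q∣≤∣p∣+∣q∣ (a ℚ.- b) (b ℚ.- c))

  ^-nonneg : ∀ {r} → 0ℚ ℚ.≤ r → ∀ k → 0ℚ ℚ.≤ r ^ℚ k
  ^-nonneg h zero    = 0≤1
  ^-nonneg h (suc k) = *-nonneg h (^-nonneg h k)

  ^-+ : ∀ r j k → r ^ℚ (j ℕ.+ k) ≡ r ^ℚ j ℚ.* r ^ℚ k
  ^-+ r zero    k = sym (ℚₚ.*-identityˡ _)
  ^-+ r (suc j) k = trans (cong (r ℚ.*_) (^-+ r j k)) (sym (ℚₚ.*-assoc r (r ^ℚ j) (r ^ℚ k)))

  ∣^∣≤ : ∀ {u r} → ℚ.∣ u ∣ ℚ.≤ r → ∀ k → ℚ.∣ u ^ℚ k ∣ ℚ.≤ r ^ℚ k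
  ∣^∣≤ h zero = ℚₚ.≤-refl
  ∣^∣≤ {u} h (suc k) = ≤ˡ (sym (ℚₚ.∣p*q∣≡∣p∣*∣q∣ u (u ^ℚ k)))
    (*-mono (ℚₚ.0≤∣p∣ u) h (ℚₚ.0≤∣p∣ (u ^ℚ k)) (∣^∣≤ h k))

  ι-suc : ∀ n → ι (suc n) ≡ 1ℚ ℚ.+ ι n
  ι-suc n = ℚₚ.toℚᵘ-injective (ℚᵘₚ.≃-trans
    (ℚₚ.toℚᵘ-fromℚᵘ (ℚᵘ.mkℚᵘ (+ suc n) 0))
    (ℚᵘₚ.≃-sym (ℚᵘₚ.≃-trans (ℚₚ.toℚᵘ-homo-+ 1ℚ (ι n))
      (ℚᵘₚ.≃-trans (ℚᵘₚ.+-congʳ ℚᵘ.1ℚᵘ (ℚₚ.toℚᵘ-fromℚᵘ (ℚᵘ.mkℚᵘ (+ n) 0)))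
        (ℚᵘ.*≡* (cong (ℤ._* + 1) (cong (λ z → + 1 ℤ.+ z) (ℤₚ.*-identityʳ (+ n)))))))))

  1/ℕ-* : ∀ m n .{{_ : ℕ.NonZero m}} .{{_ : ℕ.NonZero n}} .{{_ : ℕ.NonZero (m ℕ.* n)}} →
          1/ℕ (m ℕ.* n) ≡ 1/ℕ m ℚ.* 1/ℕ n
  1/ℕ-* (suc m) (suc n) = ℚₚ.toℚᵘ-injective (ℚᵘₚ.≃-trans
    (ℚₚ.toℚᵘ-fromℚᵘ (ℚᵘ.mkℚᵘ (+ 1) (n ℕ.+ m ℕ.* suc n)))
    (ℚᵘₚ.≃-sym (ℚᵘₚ.≃-trans (ℚₚ.toℚᵘ-homo-* (1/ℕ (suc m)) (1/ℕ (suc n)))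
      (ℚᵘₚ.*-cong (ℚₚ.toℚᵘ-fromℚᵘ (ℚᵘ.mkℚᵘ (+ 1) m)) (ℚₚ.toℚᵘ-fromℚᵘ (ℚᵘ.mkℚᵘ (+ 1) n))))))

  ι*1/ℕ : ∀ n .{{_ : ℕ.NonZero n}} → ι n ℚ.* 1/ℕ n ≡ 1ℚ
  ι*1/ℕ (suc n) = ℚₚ.toℚᵘ-injective (ℚᵘₚ.≃-trans (ℚₚ.toℚᵘ-homo-* (ι (suc n)) (1/ℕ (suc n)))
    (ℚᵘₚ.≃-trans
      (ℚᵘₚ.*-cong (ℚₚ.toℚᵘ-fromℚᵘ (ℚᵘ.mkℚᵘ (+ suc n) 0)) (ℚₚ.toℚᵘ-fromℚᵘ (ℚᵘ.mkℚᵘ (+ 1) n)))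
      (ℚᵘ.*≡* (trans (ℤₚ.*-identityʳ (+ suc n ℤ.* + 1)) (trans (ℤₚ.*-identityʳ (+ suc n))
        (sym (trans (ℤₚ.*-identityˡ _) (cong +_ (ℕₚ.*-identityˡ (suc n))))))))))

  0<1/ℕ : ∀ n .{{_ : ℕ.NonZero n}} → 0ℚ ℚ.< 1/ℕ n
  0<1/ℕ n = ℚₚ.positive⁻¹ (1/ℕ n) {{ℚₚ.normalize-pos 1 n}}

  0≤ι : ∀ n → 0ℚ ℚ.≤ ι n
  0≤ι n = ℚₚ.nonNegative⁻¹ (ι n) {{ℚₚ.normalize-nonNeg n 1}}

  ι-mono : ∀ {m n} → m ℕ.≤ n → ι m ℚ.≤ ι n
  ι-mono {n = n} ℕ.z≤n = 0≤ι n
  ι-mono {suc m} {suc n} (ℕ.s≤s h) rewrite ι-suc m | ι-suc n = ℚₚ.+-monoʳ-≤ 1ℚ (ι-mono h)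

  archimedean : ∀ p → ∃ λ K → p ℚ.≤ ι K
  archimedean p@(ℚ.mkℚ z d c) = ℤ.∣ z ∣ , ℚₚ.toℚᵘ-cancel-≤
    (ℚᵘₚ.≤-respʳ-≃ (ℚᵘₚ.≃-sym (ℚₚ.toℚᵘ-fromℚᵘ (ℚᵘ.mkℚᵘ (+ ℤ.∣ z ∣) 0)))
      (ℚᵘ.*≤* (lem z)))
    where
    lem : ∀ z → z ℤ.* + 1 ℤ.≤ + ℤ.∣ z ∣ ℤ.* + suc d
    lem (+ n) rewrite ℤₚ.*-identityʳ (+ n) | sym (ℤₚ.pos-* n (suc d)) =
      ℤ.+≤+ (ℕₚ.m≤m*n n (suc d))
    lem (ℤ.-[1+ n ]) rewrite sym (ℤₚ.pos-* (suc n) (suc d)) = ℤ.-≤+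

  bernoulli : ∀ r → 0ℚ ℚ.≤ r → r ℚ.≤ 1ℚ → ∀ K →
              r ^ℚ K ℚ.* (1ℚ ℚ.+ ι K ℚ.* (1ℚ ℚ.- r)) ℚ.≤ 1ℚ
  bernoulli r 0≤r r≤1 zero = ℚₚ.≤-reflexive
    (solve 1 (λ r → con 1ℚ :* (con 1ℚ :+ con 0ℚ :* (con 1ℚ :- r)) := con 1ℚ) refl r)
  bernoulli r 0≤r r≤1 (suc K) = ℚₚ.≤-trans
    (subst (ℚ._≤ P ℚ.* (1ℚ ℚ.+ k ℚ.* h))
      (sym (trans (cong (λ t → r ℚ.* P ℚ.* (1ℚ ℚ.+ t ℚ.* h)) (ι-suc K))
        (solve 3 (λ r P k → r :* P :* (con 1ℚ :+ (con 1ℚ :+ k) :* (con 1ℚ :- r))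
            := P :* (con 1ℚ :+ k :* (con 1ℚ :- r))
               :- P :* ((con 1ℚ :+ k) :* ((con 1ℚ :- r) :* (con 1ℚ :- r)))) refl r P k)))
      (≤ʳ (ℚₚ.+-identityʳ _)
        (ℚₚ.+-monoʳ-≤ (P ℚ.* (1ℚ ℚ.+ k ℚ.* h)) (ℚₚ.neg-antimono-≤ nn))))
    (bernoulli r 0≤r r≤1 K)
    where
    P : ℚ
    P = r ^ℚ K
    k : ℚ
    k = ι K
    h : ℚ
    h = 1ℚ ℚ.- r
    0≤h : 0ℚ ℚ.≤ h
    0≤h = p-q≤⇒ r≤1
    nn : 0ℚ ℚ.≤ P ℚ.* ((1ℚ ℚ.+ k) ℚ.* (h ℚ.* h))
    nn = *-nonneg (^-nonneg 0≤r K)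
           (*-nonneg (subst (0ℚ ℚ.≤_) (ι-suc K) (0≤ι (suc K))) (*-nonneg 0≤h 0≤h))

  ^-small : ∀ r → 0ℚ ℚ.≤ r → r ℚ.< 1ℚ → ∀ ε → 0ℚ ℚ.< ε → ∃ λ K → r ^ℚ K ℚ.≤ ε
  ^-small r 0≤r r<1 ε 0<ε =
    let h   = 1ℚ ℚ.- r
        0<h = p-q<⇒ r<1
        a , 0<a , ah = recip 0<h
        b , 0<b , bε = recip 0<ε
        K , ab≤K = archimedean (a ℚ.* b)
        P = r ^ℚ K
        0≤P = ^-nonneg 0≤r K
        0≤εh = ℚₚ.<⇒≤ (*-pos 0<ε 0<h)
        1≤  : 1ℚ ℚ.≤ (ε ℚ.* h) ℚ.* ι K
        1≤ = ≤ˡ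
               (trans (solve 4 (λ a b e h → (e :* h) :* (a :* b) := (a :* h) :* (b :* e)) refl a b ε h)
                 (trans (cong₂ ℚ._*_ ah bε) (ℚₚ.*-identityˡ 1ℚ)))
               (*-monoʳ 0≤εh ab≤K)
        step₁ : P ℚ.≤ P ℚ.* ((ε ℚ.* h) ℚ.* ι K)
        step₁ = ≤ˡ (ℚₚ.*-identityʳ P) (*-monoʳ 0≤P 1≤)
        step₂ : P ℚ.* (ι K ℚ.* h) ℚ.≤ 1ℚ
        step₂ = ℚₚ.≤-trans
          (*-monoʳ 0≤P (subst (ℚ._≤ 1ℚ ℚ.+ ι K ℚ.* h) (ℚₚ.+-identityˡ (ι K ℚ.* h)) (ℚₚ.+-monoˡ-≤ (ι K ℚ.* h) 0≤1)))
          (bernoulli r 0≤r (ℚₚ.<⇒≤ r<1) K)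
        step₃ : P ℚ.* ((ε ℚ.* h) ℚ.* ι K) ℚ.≤ ε
        step₃ = subst (ℚ._≤ ε)
          (solve 4 (λ P e h k → e :* (P :* (k :* h)) := P :* ((e :* h) :* k)) refl P ε h (ι K))
          (subst (ε ℚ.* (P ℚ.* (ι K ℚ.* h)) ℚ.≤_) (ℚₚ.*-identityʳ ε) (*-monoʳ (ℚₚ.<⇒≤ 0<ε) step₂))
    in K , ℚₚ.≤-trans step₁ step₃

  sumℚ-split : ∀ (f : ℕ → ℚ) K l → sumℚ (K ℕ.+ l) f ≡ sumℚ K f ℚ.+ sumℚ l (λ j → f (K ℕ.+ j))
  sumℚ-split f K zero rewrite ℕₚ.+-identityʳ K = sym (ℚₚ.+-identityʳ _)
  sumℚ-split f K (suc l) rewrite ℕₚ.+-suc K l | sumℚ-split f K l = ℚₚ.+-assoc (sumℚ K f) _ _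

  geometric : ∀ (g : ℕ → ℚ) A r → r ℚ.≤ 1ℚ → (∀ j → ℚ.∣ g j ∣ ℚ.≤ A ℚ.* r ^ℚ j) → ∀ l →
              (1ℚ ℚ.- r) ℚ.* ℚ.∣ sumℚ l g ∣ ℚ.≤ A ℚ.* (1ℚ ℚ.- r ^ℚ l)
  geometric g A r r≤1 bd zero = ℚₚ.≤-reflexive
    (solve 2 (λ A r → (con 1ℚ :- r) :* con 0ℚ := A :* (con 1ℚ :- con 1ℚ)) refl A r)
  geometric g A r r≤1 bd (suc l) = ℚₚ.≤-trans
    (*-monoʳ (p-q≤⇒ r≤1) (ℚₚ.≤-trans (ℚₚ.∣p+q∣≤∣p∣+∣q∣ (sumℚ l g) (g l)) (ℚₚ.+-monoʳ-≤ ℚ.∣ sumℚ l g ∣ (bd l))))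
    (subst (ℚ._≤ A ℚ.* (1ℚ ℚ.- r ℚ.* r ^ℚ l)) (sym (ℚₚ.*-distribˡ-+ (1ℚ ℚ.- r) ℚ.∣ sumℚ l g ∣ (A ℚ.* r ^ℚ l)))
      (≤ʳ
        (solve 3 (λ A r P → A :* (con 1ℚ :- P) :+ (con 1ℚ :- r) :* (A :* P)
           := A :* (con 1ℚ :- r :* P)) refl A r (r ^ℚ l))
        (ℚₚ.+-monoˡ-≤ _ (geometric g A r r≤1 bd l))))

-- Real numbers are Cauchy sequences of rationals; their equality is _≈_.
Cauchy : (ℕ → ℚ) → Set
Cauchy s = ∀ ε → 0ℚ ℚ.< ε → ∃ λ N → ∀ m n → N ℕ.≤ m → N ℕ.≤ n → ℚ.∣ s m ℚ.- s n ∣ ℚ.< ε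

record ℝ : Set where
  constructor mkℝ
  field
    seq    : ℕ → ℚ
    cauchy : Cauchy seq

open ℝ public

infix 4 _≈_ _<_ _≤_ _#_

_≈_ : ℝ → ℝ → Set
x ≈ y = ∀ ε → 0ℚ ℚ.< ε → ∃ λ N → ∀ n → N ℕ.≤ n → ℚ.∣ seq x n ℚ.- seq y n ∣ ℚ.< ε

_<_ : ℝ → ℝ → Set
x < y = ∃ λ ε → 0ℚ ℚ.< ε × ∃ λ N → ∀ n → N ℕ.≤ n → seq x n ℚ.+ ε ℚ.< seq y n

_≤_ : ℝ → ℝ → Set
x ≤ y = ∀ ε → 0ℚ ℚ.< ε → ∃ λ N → ∀ n → N ℕ.≤ n → seq x n ℚ.< seq y n ℚ.+ ε

-- Apartness: the constructive form of x ≠ y, required for division.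
_#_ : ℝ → ℝ → Set
x # y = x < y ⊎ y < x

abstract
  mkCauchy : ∀ (s : ℕ → ℚ) M₀ → 0ℚ ℚ.< M₀ →
    (∀ ε → 0ℚ ℚ.< ε → ∃ λ N → ∀ m n → N ℕ.≤ m → N ℕ.≤ n → ℚ.∣ s m ℚ.- s n ∣ ℚ.≤ M₀ ℚ.* ε) →
    Cauchy s
  mkCauchy s M₀ 0<C H ε 0<ε =
    let D , 0<D , DC = recip 0<C
        N , h = H (D ℚ.* (½ ℚ.* ε)) (*-pos 0<D (*-pos 0<½ 0<ε))
        eq : M₀ ℚ.* (D ℚ.* (½ ℚ.* ε)) ≡ ½ ℚ.* ε
        eq = trans (solve 3 (λ M₀ D t → M₀ :* (D :* t) := (D :* M₀) :* t) refl M₀ D (½ ℚ.* ε))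
               (trans (cong (ℚ._* (½ ℚ.* ε)) DC) (ℚₚ.*-identityˡ _))
        lt : ½ ℚ.* ε ℚ.< ε
        lt = subst₂′ (ℚₚ.*-monoˡ-<-pos ε {{ℚ.positive 0<ε}} ½<1)
    in N , λ m n p q → ℚₚ.≤-<-trans (≤ʳ eq (h m n p q)) lt
    where
    ½<1 : ½ ℚ.< 1ℚ
    ½<1 = ℚ.*<* (ℤ.+<+ (ℕ.s≤s (ℕ.s≤s ℕ.z≤n)))
    subst₂′ : ½ ℚ.* ε ℚ.< 1ℚ ℚ.* ε → ½ ℚ.* ε ℚ.< ε
    subst₂′ = <ʳ (ℚₚ.*-identityˡ ε)

  bounded : ∀ {s} → Cauchy s → ∃ λ M → 0ℚ ℚ.< M × ∃ λ N → ∀ n → N ℕ.≤ n → ℚ.∣ s n ∣ ℚ.≤ M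
  bounded {s} c = let N , h = c 1ℚ 0<1 in
    ℚ.∣ s N ∣ ℚ.+ 1ℚ , +-pos (ℚₚ.0≤∣p∣ (s N)) 0<1 , N , λ n N≤n →
      ℚₚ.≤-trans
        (subst (λ t → ℚ.∣ t ∣ ℚ.≤ ℚ.∣ s N ∣ ℚ.+ ℚ.∣ s n ℚ.- s N ∣)
          (solve 2 (λ a b → a :+ (b :- a) := b) refl (s N) (s n))
          (ℚₚ.∣p+q∣≤∣p∣+∣q∣ (s N) (s n ℚ.- s N)))
        (ℚₚ.+-monoʳ-≤ ℚ.∣ s N ∣ (ℚₚ.<⇒≤ (h n N N≤n ℕₚ.≤-refl)))

  const-cauchy : ∀ p → Cauchy (λ _ → p)
  const-cauchy p ε 0<ε = 0 , λ _ _ _ _ →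
    subst (λ t → ℚ.∣ t ∣ ℚ.< ε) (sym (ℚₚ.+-inverseʳ p)) 0<ε

  +-cauchy : ∀ {s t} → Cauchy s → Cauchy t → Cauchy (λ n → s n ℚ.+ t n)
  +-cauchy {s} {t} cs ct = mkCauchy (λ n → s n ℚ.+ t n) (1ℚ ℚ.+ 1ℚ) (+-pos 0≤1 0<1) λ ε 0<ε →
    let N₁ , h₁ = cs ε 0<ε
        N₂ , h₂ = ct ε 0<ε
    in N₁ ℕ.⊔ N₂ , λ m n p q →
      subst₂≤ (cong ℚ.∣_∣ (solve 4 (λ a b c d → (a :- c) :+ (b :- d) := (a :+ b) :- (c :+ d)) refl (s m) (t m) (s n) (t n)))
              (solve 1 (λ e → e :+ e := (con 1ℚ :+ con 1ℚ) :* e) refl ε)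
        (ℚₚ.≤-trans (ℚₚ.∣p+q∣≤∣p∣+∣q∣ (s m ℚ.- s n) (t m ℚ.- t n))
          (ℚₚ.+-mono-≤
            (ℚₚ.<⇒≤ (h₁ m n (ℕₚ.m⊔n≤o⇒m≤o N₁ N₂ p) (ℕₚ.m⊔n≤o⇒m≤o N₁ N₂ q)))
            (ℚₚ.<⇒≤ (h₂ m n (ℕₚ.m⊔n≤o⇒n≤o N₁ N₂ p) (ℕₚ.m⊔n≤o⇒n≤o N₁ N₂ q)))))

  neg-cauchy : ∀ {s} → Cauchy s → Cauchy (λ n → ℚ.- s n)
  neg-cauchy {s} cs ε 0<ε = let N , h = cs ε 0<ε in N , λ m n p q →
    subst (λ t → ℚ.∣ t ∣ ℚ.< ε)
      (solve 2 (λ a b → b :- a := (:- a) :- (:- b)) refl (s m) (s n)) (h n m q p)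

  *-cauchy : ∀ {s t} → Cauchy s → Cauchy t → Cauchy (λ n → s n ℚ.* t n)
  *-cauchy {s} {t} cs ct =
    let M₁ , 0<M₁ , K₁ , b₁ = bounded cs
        M₂ , 0<M₂ , K₂ , b₂ = bounded ct
    in mkCauchy (λ n → s n ℚ.* t n) (M₁ ℚ.+ M₂) (+-pos (ℚₚ.<⇒≤ 0<M₁) 0<M₂) λ ε 0<ε →
    let N₁ , h₁ = cs ε 0<ε
        N₂ , h₂ = ct ε 0<ε
        N = (N₁ ℕ.⊔ N₂) ℕ.⊔ (K₁ ℕ.⊔ K₂)
        n₁ : ∀ {m} → N ℕ.≤ m → N₁ ℕ.≤ m
        n₁ p = ℕₚ.m⊔n≤o⇒m≤o N₁ N₂ (ℕₚ.m⊔n≤o⇒m≤o _ (K₁ ℕ.⊔ K₂) p)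
        n₂ : ∀ {m} → N ℕ.≤ m → N₂ ℕ.≤ m
        n₂ p = ℕₚ.m⊔n≤o⇒n≤o N₁ N₂ (ℕₚ.m⊔n≤o⇒m≤o _ (K₁ ℕ.⊔ K₂) p)
        k₁ : ∀ {m} → N ℕ.≤ m → K₁ ℕ.≤ m
        k₁ p = ℕₚ.m⊔n≤o⇒m≤o K₁ K₂ (ℕₚ.m⊔n≤o⇒n≤o (N₁ ℕ.⊔ N₂) _ p)
        k₂ : ∀ {m} → N ℕ.≤ m → K₂ ℕ.≤ m
        k₂ p = ℕₚ.m⊔n≤o⇒n≤o K₁ K₂ (ℕₚ.m⊔n≤o⇒n≤o (N₁ ℕ.⊔ N₂) _ p)
    in N , λ m n p q →
      subst (λ w → ℚ.∣ w ∣ ℚ.≤ (M₁ ℚ.+ M₂) ℚ.* ε)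
        (solve 4 (λ a b c d → a :* (b :- d) :+ d :* (a :- c) := a :* b :- c :* d) refl (s m) (t m) (s n) (t n))
        (ℚₚ.≤-trans (ℚₚ.∣p+q∣≤∣p∣+∣q∣ (s m ℚ.* (t m ℚ.- t n)) (t n ℚ.* (s m ℚ.- s n)))
          (≤ʳ (sym (ℚₚ.*-distribʳ-+ ε M₁ M₂))
            (ℚₚ.+-mono-≤
              (prod (s m) (t m ℚ.- t n) (b₁ m (k₁ p)) (ℚₚ.<⇒≤ (h₂ m n (n₂ p) (n₂ q))))
              (prod (t n) (s m ℚ.- s n) (b₂ n (k₂ q)) (ℚₚ.<⇒≤ (h₁ m n (n₁ p) (n₁ q)))))))
    where
    prod : ∀ a b {c d} → ℚ.∣ a ∣ ℚ.≤ c → ℚ.∣ b ∣ ℚ.≤ d → ℚ.∣ a ℚ.* b ∣ ℚ.≤ c ℚ.* d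
    prod a b h k = ≤ˡ (sym (ℚₚ.∣p*q∣≡∣p∣*∣q∣ a b))
      (*-mono (ℚₚ.0≤∣p∣ a) h (ℚₚ.0≤∣p∣ b) k)

fromℚ : ℚ → ℝ
fromℚ p = mkℝ (λ _ → p) (const-cauchy p)

0ℝ 1ℝ : ℝ
0ℝ = fromℚ 0ℚ
1ℝ = fromℚ 1ℚ

infix  8 -_
infixl 7 _*_
infixl 6 _+_ _-_
infixr 9 _^_

_+_ : ℝ → ℝ → ℝ
x + y = mkℝ (λ n → seq x n ℚ.+ seq y n) (+-cauchy {seq x} {seq y} (cauchy x) (cauchy y))

_*_ : ℝ → ℝ → ℝ
x * y = mkℝ (λ n → seq x n ℚ.* seq y n) (*-cauchy {seq x} {seq y} (cauchy x) (cauchy y))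

-_ : ℝ → ℝ
- x = mkℝ (λ n → ℚ.- seq x n) (neg-cauchy {seq x} (cauchy x))

_-_ : ℝ → ℝ → ℝ
x - y = x + (- y)

_^_ : ℝ → ℕ → ℝ
x ^ zero  = 1ℝ
x ^ suc k = x * x ^ k

sum : ℕ → (ℕ → ℝ) → ℝ
sum zero    f = 0ℝ
sum (suc n) f = sum n f + f n

∑[_⋯_] : ℕ → ℕ → (ℕ → ℝ) → ℝ
∑[ a ⋯ b ] f = sum (suc b ∸ a) (λ j → f (a ℕ.+ j))

-- The value at 0 is irrelevant: a sequence representing a real number
-- apart from 0 is eventually nonzero.
invℚ : ℚ → ℚ
invℚ p with p ℚₚ.≟ 0ℚ
... | yes _  = 0ℚ
... | no p≢0 = (ℚ.1/ p) {{ℚ.≢-nonZero p≢0}}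

abstract
  invℚ-inverse : ∀ p → p ≢ 0ℚ → invℚ p ℚ.* p ≡ 1ℚ
  invℚ-inverse p p≢0 with p ℚₚ.≟ 0ℚ
  ... | yes e = contradiction e p≢0
  ... | no h  = ℚₚ.*-inverseˡ p {{ℚ.≢-nonZero h}}

  #⇒away : ∀ x → x # 0ℝ → ∃ λ δ → 0ℚ ℚ.< δ × ∃ λ N → ∀ n → N ℕ.≤ n → δ ℚ.≤ ℚ.∣ seq x n ∣
  #⇒away x (inj₁ (ε , 0<ε , N , h)) = ε , 0<ε , N , λ n p →
    subst (ε ℚ.≤_) (ℚₚ.∣-p∣≡∣p∣ (seq x n)) (ℚₚ.≤-trans
      (subst₂≤ (solve 2 (λ a e → (a :+ e) :+ (:- a) := e) refl (seq x n) ε) (ℚₚ.+-identityˡ _)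
        (ℚₚ.+-monoˡ-≤ (ℚ.- seq x n) (ℚₚ.<⇒≤ (h n p))))
      (≤∣∣ (ℚ.- seq x n)))
  #⇒away x (inj₂ (ε , 0<ε , N , h)) = ε , 0<ε , N , λ n p →
    ℚₚ.≤-trans (subst (ℚ._≤ seq x n) (ℚₚ.+-identityˡ ε) (ℚₚ.<⇒≤ (h n p))) (≤∣∣ (seq x n))

  inv-cauchy : ∀ x → x # 0ℝ → Cauchy (λ n → invℚ (seq x n))
  inv-cauchy x x#0 =
    let δ , 0<δ , K , away = #⇒away x x#0
        D , 0<D , Dδ = recip 0<δ
        nz : ∀ n → K ℕ.≤ n → seq x n ≢ 0ℚ
        nz n p e = ℚₚ.<⇒≢ (ℚₚ.<-≤-trans 0<δ (away n p)) (sym (cong ℚ.∣_∣ e))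
        bd : ∀ n → K ℕ.≤ n → ℚ.∣ invℚ (seq x n) ∣ ℚ.≤ D
        bd n p =
          let a = seq x n
              b = invℚ a
              e : ℚ.∣ b ∣ ℚ.* ℚ.∣ a ∣ ≡ 1ℚ
              e = trans (sym (ℚₚ.∣p*q∣≡∣p∣*∣q∣ b a)) (cong ℚ.∣_∣ (invℚ-inverse a (nz n p)))
              l : ℚ.∣ b ∣ ℚ.* δ ℚ.≤ 1ℚ
              l = subst (ℚ.∣ b ∣ ℚ.* δ ℚ.≤_) e (*-monoʳ (ℚₚ.0≤∣p∣ b) (away n p))
              g : D ℚ.* (ℚ.∣ b ∣ ℚ.* δ) ≡ ℚ.∣ b ∣
              g = trans (solve 3 (λ D b d → D :* (b :* d) := b :* (D :* d)) refl D ℚ.∣ b ∣ δ)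
                    (trans (cong (ℚ.∣ b ∣ ℚ.*_) Dδ) (ℚₚ.*-identityʳ _))
          in subst₂≤ g (ℚₚ.*-identityʳ D) (*-monoʳ (ℚₚ.<⇒≤ 0<D) l)
    in mkCauchy (λ n → invℚ (seq x n)) (D ℚ.* D) (*-pos 0<D 0<D) λ ε 0<ε →
    let N , h = cauchy x ε 0<ε in N ℕ.⊔ K , λ m n p q →
    let a = seq x m ; a′ = invℚ a ; b = seq x n ; b′ = invℚ b
        km = ℕₚ.m⊔n≤o⇒n≤o N K p
        kn = ℕₚ.m⊔n≤o⇒n≤o N K q
        e : (a′ ℚ.* b′) ℚ.* (b ℚ.- a) ≡ a′ ℚ.- b′
        e = trans (solve 4 (λ a a′ b b′ → (a′ :* b′) :* (b :- a) := a′ :* (b′ :* b) :- b′ :* (a′ :* a)) refl a a′ b b′)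
              (trans (cong₂ (λ s t → a′ ℚ.* s ℚ.- b′ ℚ.* t) (invℚ-inverse b (nz n kn)) (invℚ-inverse a (nz m km)))
                (solve 2 (λ a b → a :* con 1ℚ :- b :* con 1ℚ := a :- b) refl a′ b′))
    in subst (λ t → ℚ.∣ t ∣ ℚ.≤ (D ℚ.* D) ℚ.* ε) e
         (prod (a′ ℚ.* b′) (b ℚ.- a) (prod a′ b′ (bd m km) (bd n kn))
           (ℚₚ.<⇒≤ (h n m (ℕₚ.m⊔n≤o⇒m≤o N K q) (ℕₚ.m⊔n≤o⇒m≤o N K p))))
    where
    prod : ∀ a b {c d} → ℚ.∣ a ∣ ℚ.≤ c → ℚ.∣ b ∣ ℚ.≤ d → ℚ.∣ a ℚ.* b ∣ ℚ.≤ c ℚ.* d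
    prod a b h k = ≤ˡ (sym (ℚₚ.∣p*q∣≡∣p∣*∣q∣ a b))
      (*-mono (ℚₚ.0≤∣p∣ a) h (ℚₚ.0≤∣p∣ b) k)

inv : (x : ℝ) → x # 0ℝ → ℝ
inv x x#0 = mkℝ (λ n → invℚ (seq x n)) (inv-cauchy x x#0)

-- From index K₀ on, the terms are dominated by M₀ · r ^ j with r < 1.
record GeometricTail (f : ℕ → ℝ) : Set where
  field
    K₀ N₀ : ℕ
    M₀ r   : ℚ
    0≤M₀   : 0ℚ ℚ.≤ M₀
    0≤r   : 0ℚ ℚ.≤ r
    r<1   : r ℚ.< 1ℚ
    bound : ∀ j n → N₀ ℕ.≤ n → ℚ.∣ seq (f (K₀ ℕ.+ j)) n ∣ ℚ.≤ M₀ ℚ.* r ^ℚ j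

abstract
  seq-sum : ∀ k (f : ℕ → ℝ) n → seq (sum k f) n ≡ sumℚ k (λ j → seq (f j) n)
  seq-sum zero    f n = refl
  seq-sum (suc k) f n = cong (ℚ._+ seq (f k) n) (seq-sum k f n)

  tail : ∀ {f} (G : GeometricTail f) → let open GeometricTail G in
    ∃ λ E → 0ℚ ℚ.≤ E × (∀ J m n → N₀ ℕ.≤ n → K₀ ℕ.+ J ℕ.≤ m →
      ℚ.∣ sumℚ m (λ k → seq (f k) n) ℚ.- sumℚ (K₀ ℕ.+ J) (λ k → seq (f k) n) ∣ ℚ.≤ E ℚ.* r ^ℚ J)
  tail {f} G = D ℚ.* M₀ , *-nonneg (ℚₚ.<⇒≤ 0<D) 0≤M₀ , main
    where
    open GeometricTail G
    h : ℚ
    h = 1ℚ ℚ.- r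
    rc : ∃ λ b → 0ℚ ℚ.< b × b ℚ.* h ≡ 1ℚ
    rc = recip (p-q<⇒ r<1)
    D : ℚ
    D = proj₁ rc
    0<D : 0ℚ ℚ.< D
    0<D = proj₁ (proj₂ rc)
    Dh : D ℚ.* h ≡ 1ℚ
    Dh = proj₂ (proj₂ rc)
    main : ∀ J m n → N₀ ℕ.≤ n → K₀ ℕ.+ J ℕ.≤ m →
      ℚ.∣ sumℚ m (λ k → seq (f k) n) ℚ.- sumℚ (K₀ ℕ.+ J) (λ k → seq (f k) n) ∣ ℚ.≤ (D ℚ.* M₀) ℚ.* r ^ℚ J
    main J m n N₀≤n K≤m with ℕₚ.m≤n⇒∃[o]m+o≡n K≤m
    ... | l , refl =
      subst (λ t → ℚ.∣ t ∣ ℚ.≤ (D ℚ.* M₀) ℚ.* r ^ℚ J)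
        (sym (trans (cong (ℚ._- sumℚ (K₀ ℕ.+ J) F) (sumℚ-split F (K₀ ℕ.+ J) l))
          (solve 2 (λ a b → (a :+ b) :- a := b) refl (sumℚ (K₀ ℕ.+ J) F) S)))
        (≤ˡ (trans (sym (ℚₚ.*-assoc D h ℚ.∣ S ∣)) (trans (cong (ℚ._* ℚ.∣ S ∣) Dh) (ℚₚ.*-identityˡ _)))
          (≤ʳ (sym (ℚₚ.*-assoc D M₀ (r ^ℚ J)))
            (*-monoʳ (ℚₚ.<⇒≤ 0<D) (ℚₚ.≤-trans (geometric g A r (ℚₚ.<⇒≤ r<1) bd l) le))))
      where
      F : ℕ → ℚ
      F k = seq (f k) n
      g : ℕ → ℚ
      g j = F (K₀ ℕ.+ J ℕ.+ j)
      S : ℚ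
      S = sumℚ l g
      A : ℚ
      A = M₀ ℚ.* r ^ℚ J
      bd : ∀ j → ℚ.∣ g j ∣ ℚ.≤ A ℚ.* r ^ℚ j
      bd j = subst (ℚ.∣ g j ∣ ℚ.≤_)
        (trans (cong (M₀ ℚ.*_) (^-+ r J j)) (sym (ℚₚ.*-assoc M₀ _ _)))
        (subst (λ k → ℚ.∣ F k ∣ ℚ.≤ M₀ ℚ.* r ^ℚ (J ℕ.+ j)) (sym (ℕₚ.+-assoc K₀ J j)) (bound (J ℕ.+ j) n N₀≤n))
      le : A ℚ.* (1ℚ ℚ.- r ^ℚ l) ℚ.≤ A
      le = ≤ʳ (ℚₚ.*-identityʳ A) (*-monoʳ (*-nonneg 0≤M₀ (^-nonneg 0≤r J))
        (≤ʳ (ℚₚ.+-identityʳ 1ℚ) (ℚₚ.+-monoʳ-≤ 1ℚ (ℚₚ.neg-antimono-≤ (^-nonneg 0≤r l)))))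

  series-cauchy : ∀ f → GeometricTail f → Cauchy (λ n → sumℚ n (λ k → seq (f k) n))
  series-cauchy f G = mkCauchy (λ n → sumℚ n (λ k → seq (f k) n)) (E ℚ.+ (E ℚ.+ 1ℚ)) (+-pos 0≤E (+-pos 0≤E 0<1)) λ ε 0<ε →
    let J , rJ≤ε = ^-small r 0≤r r<1 ε 0<ε
        K = K₀ ℕ.+ J
        N , h = cauchy (sum K f) ε 0<ε
        M = N ℕ.⊔ (N₀ ℕ.⊔ K)
        near : ∀ m → M ℕ.≤ m → ℚ.∣ D m m ℚ.- D K m ∣ ℚ.≤ E ℚ.* ε
        near m p = ℚₚ.≤-trans
          (proj₂ (proj₂ (tail G)) J m m
            (ℕₚ.m⊔n≤o⇒m≤o N₀ K (ℕₚ.m⊔n≤o⇒n≤o N (N₀ ℕ.⊔ K) p))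
            (ℕₚ.m⊔n≤o⇒n≤o N₀ K (ℕₚ.m⊔n≤o⇒n≤o N (N₀ ℕ.⊔ K) p)))
          (*-monoʳ 0≤E rJ≤ε)
        mid : ∀ m n → M ℕ.≤ m → M ℕ.≤ n → ℚ.∣ D K m ℚ.- D K n ∣ ℚ.≤ ε
        mid m n p q = subst (ℚ._≤ ε)
          (cong₂ (λ a b → ℚ.∣ a ℚ.- b ∣) (seq-sum K f m) (seq-sum K f n))
          (ℚₚ.<⇒≤ (h m n (ℕₚ.m⊔n≤o⇒m≤o N (N₀ ℕ.⊔ K) p) (ℕₚ.m⊔n≤o⇒m≤o N (N₀ ℕ.⊔ K) q)))
    in M , λ m n p q →
      ≤ʳ (solve 2 (λ E e → E :* e :+ (e :+ E :* e) := (E :+ (E :+ con 1ℚ)) :* e) refl E ε)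
        (ℚₚ.≤-trans (triangle (D m m) (D K m) (D n n))
          (ℚₚ.+-mono-≤ (near m p)
            (ℚₚ.≤-trans (triangle (D K m) (D K n) (D n n))
              (ℚₚ.+-mono-≤ (mid m n p q)
                (≤ˡ (∣-∣-sym (D n n) (D K n)) (near n q))))))
    where
    open GeometricTail G
    D : ℕ → ℕ → ℚ
    D k n = sumℚ k (λ j → seq (f j) n)
    E : ℚ
    E = proj₁ (tail G)
    0≤E : 0ℚ ℚ.≤ E
    0≤E = proj₁ (proj₂ (tail G))

-- The n-th approximation of ∑_{k<∞} f k is the n-th approximation of
-- ∑_{k<n} f k; as the tails are uniformly small, the real number so
-- represented is the limit of the partial sums (series-limit below).
series : (f : ℕ → ℝ) → GeometricTail f → ℝ
series f G = mkℝ (λ n → sumℚ n (λ k → seq (f k) n)) (series-cauchy f G)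

_⟶_ : (ℕ → ℝ) → ℝ → Set
s ⟶ x = ∀ ε → 0ℚ ℚ.< ε → ∃ λ K → ∀ k → K ℕ.≤ k → s k ≤ x + fromℚ ε × x ≤ s k + fromℚ ε

abstract
  series-limit : ∀ f G → (λ k → sum k f) ⟶ series f G
  series-limit f G ε 0<ε = K , λ k K≤k → (λ δ 0<δ → M k , λ n p → lo k n K≤k p δ 0<δ) , (λ δ 0<δ → M k , λ n p → hi k n K≤k p δ 0<δ)
    where
    open GeometricTail G
    E′ : ℚ
    E′ = proj₁ (tail G)
    E : ℚ
    E = E′ ℚ.+ (E′ ℚ.+ 1ℚ)
    0≤E′ : 0ℚ ℚ.≤ E′
    0≤E′ = proj₁ (proj₂ (tail G))
    rc : ∃ λ b → 0ℚ ℚ.< b × b ℚ.* E ≡ 1ℚ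
    rc = recip (+-pos 0≤E′ (+-pos 0≤E′ 0<1))
    sm : ∃ λ j → r ^ℚ j ℚ.≤ proj₁ rc ℚ.* ε
    sm = ^-small r 0≤r r<1 (proj₁ rc ℚ.* ε) (*-pos (proj₁ (proj₂ rc)) 0<ε)
    J : ℕ
    J = proj₁ sm
    K : ℕ
    K = K₀ ℕ.+ J
    M : ℕ → ℕ
    M k = N₀ ℕ.⊔ (K ℕ.⊔ k)
    D : ℕ → ℕ → ℚ
    D k n = sumℚ k (λ j → seq (f j) n)
    η : ℚ
    η = proj₁ rc ℚ.* ε
    Eη : E ℚ.* η ≡ ε
    Eη = trans (solve 3 (λ a b c → a :* (b :* c) := (b :* a) :* c) refl E (proj₁ rc) ε)
           (trans (cong (ℚ._* ε) (proj₂ (proj₂ rc))) (ℚₚ.*-identityˡ ε))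
    close : ∀ k n → K ℕ.≤ k → M k ℕ.≤ n → ℚ.∣ D k n ℚ.- D n n ∣ ℚ.≤ ε
    close k n K≤k p =
      let N₀≤n = ℕₚ.m⊔n≤o⇒m≤o N₀ (K ℕ.⊔ k) p
          K≤n  = ℕₚ.m⊔n≤o⇒m≤o K k (ℕₚ.m⊔n≤o⇒n≤o N₀ (K ℕ.⊔ k) p)
          t : ∀ m → K ℕ.≤ m → ℚ.∣ D m n ℚ.- D K n ∣ ℚ.≤ E′ ℚ.* η
          t m K≤m = ℚₚ.≤-trans (proj₂ (proj₂ (tail G)) J m n N₀≤n K≤m) (*-monoʳ 0≤E′ (proj₂ sm))
          0≤η = ℚₚ.<⇒≤ (*-pos (proj₁ (proj₂ rc)) 0<ε)
      in ℚₚ.≤-trans (triangle (D k n) (D K n) (D n n))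
         (ℚₚ.≤-trans (ℚₚ.+-mono-≤ (t k K≤k) (≤ˡ (∣-∣-sym (D n n) (D K n)) (t n K≤n)))
           (≤ʳ (trans (solve 2 (λ E e → (E :* e :+ E :* e) :+ e := (E :+ (E :+ con 1ℚ)) :* e) refl E′ η) Eη)
             (≤ˡ (ℚₚ.+-identityʳ (E′ ℚ.* η ℚ.+ E′ ℚ.* η)) (ℚₚ.+-monoʳ-≤ (E′ ℚ.* η ℚ.+ E′ ℚ.* η) 0≤η))))
    conv : ∀ {a b} δ → 0ℚ ℚ.< δ → ℚ.∣ a ℚ.- b ∣ ℚ.≤ ε → a ℚ.< (b ℚ.+ ε) ℚ.+ δ
    conv {a} {b} δ 0<δ h = ℚₚ.≤-<-trans
      (subst (ℚ._≤ b ℚ.+ ε) (solve 2 (λ a b → b :+ (a :- b) := a) refl a b)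
        (ℚₚ.+-monoʳ-≤ b (ℚₚ.≤-trans (≤∣∣ (a ℚ.- b)) h)))
      (subst (ℚ._< (b ℚ.+ ε) ℚ.+ δ) (ℚₚ.+-identityʳ _) (ℚₚ.+-monoʳ-< (b ℚ.+ ε) 0<δ))
    lo : ∀ k n → K ℕ.≤ k → M k ℕ.≤ n → ∀ δ → 0ℚ ℚ.< δ → seq (sum k f) n ℚ.< (D n n ℚ.+ ε) ℚ.+ δ
    lo k n K≤k p δ 0<δ = <ˡ (sym (seq-sum k f n)) (conv δ 0<δ (close k n K≤k p))
    hi : ∀ k n → K ℕ.≤ k → M k ℕ.≤ n → ∀ δ → 0ℚ ℚ.< δ → D n n ℚ.< (seq (sum k f) n ℚ.+ ε) ℚ.+ δ
    hi k n K≤k p δ 0<δ = subst (λ t → D n n ℚ.< (t ℚ.+ ε) ℚ.+ δ) (sym (seq-sum k f n))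
      (conv δ 0<δ (subst (ℚ._≤ ε) (∣-∣-sym (D k n) (D n n)) (close k n K≤k p)))

1/!_ : ℕ → ℝ
1/! k = fromℚ (1/ℕ (k !) {{k ℕₚ.!≢0}})

expTerm : ℝ → ℕ → ℝ
expTerm x k = x ^ k * 1/! k

-- Mercator's series: -log q = ∑_{k≥0} (1 - q)^(k+1) / (k+1) for 0 < q < 1.
logTerm : ℝ → ℕ → ℝ
logTerm q k = (1ℝ - q) ^ suc k * fromℚ (1/ℕ (suc k))

abstract
  seq-^ : ∀ x k n → seq (x ^ k) n ≡ seq x n ^ℚ k
  seq-^ x zero    n = refl
  seq-^ x (suc k) n = cong (seq x n ℚ.*_) (seq-^ x k n)

  1/ℕ≤1 : ∀ k → 1/ℕ (suc k) ℚ.≤ 1ℚ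
  1/ℕ≤1 k = subst (ℚ._≤ 1ℚ) (ℚₚ.*-identityˡ _)
    (subst (1ℚ ℚ.* 1/ℕ (suc k) ℚ.≤_) (ι*1/ℕ (suc k))
      (ℚₚ.*-monoʳ-≤-nonNeg (1/ℕ (suc k)) {{ℚ.nonNegative (ℚₚ.<⇒≤ (0<1/ℕ (suc k)))}}
        (ι-mono (ℕ.s≤s (ℕ.z≤n {k})))))

  expTailFrom : ∀ x R → 0ℚ ℚ.< R → ∀ N → (∀ n → N ℕ.≤ n → ℚ.∣ seq x n ∣ ℚ.≤ R) →
                ∀ K → (1ℚ ℚ.+ 1ℚ) ℚ.* R ℚ.≤ ι K → GeometricTail (expTerm x)
  expTailFrom x R 0<R N R-bd K 2R≤K = record
    { K₀ = K ; N₀ = N ; M₀ = M₀ ; r = ½ ; 0≤M₀ = 0≤M₀ ; 0≤r = ℚₚ.<⇒≤ 0<½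
    ; r<1 = ℚ.*<* (ℤ.+<+ (ℕ.s≤s (ℕ.s≤s ℕ.z≤n)))
    ; bound = λ j n p → subst (λ t → ℚ.∣ t ℚ.* w (K ℕ.+ j) ∣ ℚ.≤ M₀ ℚ.* ½ ^ℚ j)
                (sym (seq-^ x (K ℕ.+ j) n)) (bd n p j) }
    where
    w : ℕ → ℚ
    w k = 1/ℕ (k !) {{k ℕₚ.!≢0}}
    0≤w : ∀ k → 0ℚ ℚ.≤ w k
    0≤w k = ℚₚ.<⇒≤ (0<1/ℕ (k !) {{k ℕₚ.!≢0}})
    M₀ : ℚ
    M₀ = R ^ℚ K ℚ.* w K
    0≤M₀ : 0ℚ ℚ.≤ M₀
    0≤M₀ = *-nonneg (^-nonneg (ℚₚ.<⇒≤ 0<R) K) (0≤w K)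
    ratio : ∀ k → K ℕ.≤ k → R ℚ.* 1/ℕ (suc k) ℚ.≤ ½
    ratio k K≤k = subst₂≤
      (solve 2 (λ R d → (con ½ :* d) :* ((con 1ℚ :+ con 1ℚ) :* R) := R :* d) refl R d)
      (trans (solve 2 (λ i d → (con ½ :* d) :* i := con ½ :* (i :* d)) refl (ι (suc k)) d)
        (trans (cong (½ ℚ.*_) (ι*1/ℕ (suc k))) (ℚₚ.*-identityʳ ½)))
      (*-monoʳ (*-nonneg (ℚₚ.<⇒≤ 0<½) (ℚₚ.<⇒≤ (0<1/ℕ (suc k))))
        (ℚₚ.≤-trans 2R≤K (ι-mono (ℕₚ.m≤n⇒m≤1+n K≤k))))
      where
      d : ℚ
      d = 1/ℕ (suc k)
    abs-bd : ∀ n → N ℕ.≤ n → ∀ k → ℚ.∣ seq x n ^ℚ k ℚ.* w k ∣ ℚ.≤ R ^ℚ k ℚ.* w k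
    abs-bd n p k = subst (ℚ._≤ R ^ℚ k ℚ.* w k)
      (sym (trans (ℚₚ.∣p*q∣≡∣p∣*∣q∣ (seq x n ^ℚ k) (w k)) (cong (ℚ.∣ seq x n ^ℚ k ∣ ℚ.*_) (ℚₚ.0≤p⇒∣p∣≡p (0≤w k)))))
      (ℚₚ.*-monoʳ-≤-nonNeg (w k) {{ℚ.nonNegative (0≤w k)}} (∣^∣≤ (R-bd n p) k))
    step : ∀ j → R ^ℚ (K ℕ.+ j) ℚ.* w (K ℕ.+ j) ℚ.≤ M₀ ℚ.* ½ ^ℚ j
    step zero rewrite ℕₚ.+-identityʳ K = ℚₚ.≤-reflexive (sym (ℚₚ.*-identityʳ M₀))
    step (suc j) rewrite ℕₚ.+-suc K j = subst₂≤
      (trans (solve 4 (λ R P d w → (R :* d) :* (P :* w) := (R :* P) :* (d :* w)) refl R (R ^ℚ k) (1/ℕ (suc k)) (w k))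
        (cong (R ^ℚ suc k ℚ.*_) (sym (1/ℕ-* (suc k) (k !) {{_}} {{k ℕₚ.!≢0}} {{suc k ℕₚ.!≢0}}))))
      (solve 2 (λ M₀ h → con ½ :* (M₀ :* h) := M₀ :* (con ½ :* h)) refl M₀ (½ ^ℚ j))
      (*-mono (*-nonneg (ℚₚ.<⇒≤ 0<R) (ℚₚ.<⇒≤ (0<1/ℕ (suc k)))) (ratio k (ℕₚ.m≤m+n K j))
        (*-nonneg (^-nonneg (ℚₚ.<⇒≤ 0<R) k) (0≤w k)) (step j))
      where
      k : ℕ
      k = K ℕ.+ j
    bd : ∀ n → N ℕ.≤ n → ∀ j → ℚ.∣ seq x n ^ℚ (K ℕ.+ j) ℚ.* w (K ℕ.+ j) ∣ ℚ.≤ M₀ ℚ.* ½ ^ℚ j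
    bd n p j = ℚₚ.≤-trans (abs-bd n p (K ℕ.+ j)) (step j)

  expTail : ∀ x → GeometricTail (expTerm x)
  expTail x =
    let R , 0<R , N , R-bd = bounded (cauchy x)
        K , 2R≤K = archimedean ((1ℚ ℚ.+ 1ℚ) ℚ.* R)
    in expTailFrom x R 0<R N R-bd K 2R≤K

  logTail : ∀ q → 0ℝ < q → q < 1ℝ → GeometricTail (logTerm q)
  logTail q (ε , 0<ε , N , h) (ε′ , 0<ε′ , N′ , h′) = record
    { K₀ = 0 ; N₀ = M ; M₀ = 1ℚ ; r = r ; 0≤M₀ = 0≤1 ; 0≤r = 0≤r ; r<1 = r<1
    ; bound = λ j n p → ≤ˡ (cong ℚ.∣_∣ (sym (term≡ j n))) (bd n p j) }
    where
    M : ℕ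
    M = N ℕ.⊔ N′
    r : ℚ
    r = 1ℚ ℚ.- ε
    u : ℕ → ℚ
    u n = seq (1ℝ - q) n
    term≡ : ∀ j n → seq (logTerm q j) n ≡ u n ^ℚ suc j ℚ.* 1/ℕ (suc j)
    term≡ j n = cong (ℚ._* 1/ℕ (suc j)) (seq-^ (1ℝ - q) (suc j) n)
    u≤r : ∀ n → M ℕ.≤ n → u n ℚ.≤ r
    u≤r n p = ℚₚ.+-monoʳ-≤ 1ℚ (ℚₚ.neg-antimono-≤
      (subst (ℚ._≤ seq q n) (ℚₚ.+-identityˡ ε) (ℚₚ.<⇒≤ (h n (ℕₚ.m⊔n≤o⇒m≤o N N′ p)))))
    0≤u : ∀ n → M ℕ.≤ n → 0ℚ ℚ.≤ u n
    0≤u n p = p-q≤⇒ {seq q n} {1ℚ} (ℚₚ.≤-trans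
      (subst (ℚ._≤ seq q n ℚ.+ ε′) (ℚₚ.+-identityʳ (seq q n)) (ℚₚ.+-monoʳ-≤ (seq q n) (ℚₚ.<⇒≤ 0<ε′)))
      (ℚₚ.<⇒≤ (h′ n (ℕₚ.m⊔n≤o⇒n≤o N N′ p))))
    0≤r : 0ℚ ℚ.≤ r
    0≤r = ℚₚ.≤-trans (0≤u M ℕₚ.≤-refl) (u≤r M ℕₚ.≤-refl)
    r<1 : r ℚ.< 1ℚ
    r<1 = subst (r ℚ.<_) (ℚₚ.+-identityʳ 1ℚ) (ℚₚ.+-monoʳ-< 1ℚ (ℚₚ.neg-antimono-< 0<ε))
    bd : ∀ n → M ℕ.≤ n → ∀ j → ℚ.∣ u n ℚ.* u n ^ℚ j ℚ.* 1/ℕ (suc j) ∣ ℚ.≤ 1ℚ ℚ.* r ^ℚ j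
    bd n p j = subst₂≤
      (sym (trans (ℚₚ.∣p*q∣≡∣p∣*∣q∣ (u n ℚ.* u n ^ℚ j) (1/ℕ (suc j)))
        (trans (cong₂ ℚ._*_ (ℚₚ.∣p*q∣≡∣p∣*∣q∣ (u n) (u n ^ℚ j)) (ℚₚ.0≤p⇒∣p∣≡p 0≤d)) refl)))
      (ℚₚ.*-identityʳ _)
      (*-mono (*-nonneg (ℚₚ.0≤∣p∣ (u n)) (ℚₚ.0≤∣p∣ (u n ^ℚ j)))
        (*-mono (ℚₚ.0≤∣p∣ (u n)) (ℚₚ.≤-trans ∣u∣≤r (ℚₚ.<⇒≤ r<1)) (ℚₚ.0≤∣p∣ (u n ^ℚ j)) (∣^∣≤ ∣u∣≤r j))
        0≤d (1/ℕ≤1 j))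
      where
      0≤d : 0ℚ ℚ.≤ 1/ℕ (suc j)
      0≤d = ℚₚ.<⇒≤ (0<1/ℕ (suc j))
      ∣u∣≤r : ℚ.∣ u n ∣ ℚ.≤ r
      ∣u∣≤r = subst (ℚ._≤ r) (sym (ℚₚ.0≤p⇒∣p∣≡p (0≤u n p))) (u≤r n p)

exp : ℝ → ℝ
exp x = series (expTerm x) (expTail x)

log : (q : ℝ) → 0ℝ < q → q < 1ℝ → ℝ
log q 0<q q<1 = - series (logTerm q) (logTail q 0<q q<1)

-- q^x = e^(x log q)
rpow : (q : ℝ) → 0ℝ < q → q < 1ℝ → ℝ → ℝ
rpow q 0<q q<1 x = exp (x * log q 0<q q<1)

-- Formal power series in t over ℝ, as coefficient sequences.
PowerSeries : Set
PowerSeries = ℕ → ℝ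

infix 4 _≋_

_≋_ : PowerSeries → PowerSeries → Set
f ≋ g = ∀ n → f n ≈ g n

infixl 7 _⊛_ _·_

_⊛_ : PowerSeries → PowerSeries → PowerSeries
(f ⊛ g) n = ∑[ 0 ⋯ n ] λ j → f j * g (n ∸ j)

_·_ : ℝ → PowerSeries → PowerSeries
(c · f) n = c * f n

t^_ : ℕ → PowerSeries
(t^ k) n = if n ℕ.≡ᵇ k then 1ℝ else 0ℝ

-- e^{at}
expSeries : ℝ → PowerSeries
expSeries a n = a ^ n * 1/! n

-- ∑ₙ aₙ tⁿ / n!
egf : (ℕ → ℝ) → PowerSeries
egf a n = a n * 1/! n

nCk-nonZero : ∀ {n k} → k ℕ.≤ n → ℕ.NonZero (n C k)
nCk-nonZero {n} {zero} _ = _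
nCk-nonZero {suc n} {suc k} (ℕ.s≤s k≤n) = ℕ.>-nonZero (subst (0 ℕ.<_)
  (nCk+nC[k+1]≡[n+1]C[k+1] n k)
  (ℕₚ.<-≤-trans (ℕ.>-nonZero⁻¹ (n C k) {{nCk-nonZero k≤n}}) (ℕₚ.m≤m+n (n C k) (n C suc k))))

-- (k choose i) / (n choose i); k C i is 0 for k < i.
binomialRatio : (k n i : ℕ) → i ℕ.≤ n → ℝ
binomialRatio k n i i≤n = fromℚ ((+ (k C i)) ℚ./ (n C i))
  where instance _ = nCk-nonZero i≤n

module _ (q : ℝ) (0<q : 0ℝ < q) (q<1 : q < 1ℝ) where

  abstract
    1-q#0 : (1ℝ - q) # 0ℝ
    1-q#0 = let ε , 0<ε , N , h = q<1 in
      inj₂ (ε , 0<ε , N , λ n p → subst₂< (solve 2 (λ a e → (a :+ e) :+ (:- a) := con 0ℚ :+ e) refl (seq q n) ε)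
        (ℚₚ.+-monoˡ-< (ℚ.- seq q n) (h n p)))
      where
      subst₂< : ∀ {a b c} → a ≡ b → a ℚ.< c → b ℚ.< c
      subst₂< refl h = h

  -- [x]_q = (1 - q^x) / (1 - q)
  qNumber : ℝ → ℝ
  qNumber x = (1ℝ - rpow q 0<q q<1 x) * inv (1ℝ - q) 1-q#0

  -- t^k e^{[1-x]_q t} [x]_q^k / k!
  bernsteinGF : ℝ → ℕ → PowerSeries
  bernsteinGF x k = (qNumber x ^ k * 1/! k) · (t^ k ⊛ expSeries (qNumber (1ℝ - x)))

  -- B k n stands for B_{k,n}(x,q); the defining identity of generating
  -- functions is read as an identity of formal power series in t.
  IsModifiedBernstein : ℝ → (ℕ → ℕ → ℝ) → Set
  IsModifiedBernstein x B = ∀ k → bernsteinGF x k ≋ egf (B k)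

  modifiedBernstein-exists : ∀ x → ∃ (IsModifiedBernstein x)
  modifiedBernstein-exists x =
    (λ k n → bernsteinGF x k n * fromℚ (ι (n !))) , λ k n ε 0<ε → 0 , λ m _ →
      let c = seq (bernsteinGF x k n) m
          e : c ℚ.- c ℚ.* ι (n !) ℚ.* 1/ℕ (n !) {{n ℕₚ.!≢0}} ≡ 0ℚ
          e = trans (cong (λ z → c ℚ.- z) (trans (ℚₚ.*-assoc c _ _)
                (trans (cong (c ℚ.*_) (ι*1/ℕ (n !) {{n ℕₚ.!≢0}})) (ℚₚ.*-identityʳ c))))
                (ℚₚ.+-inverseʳ c)
      in subst (λ z → ℚ.∣ z ∣ ℚ.< ε) (sym e) 0<ε

{-# OPTIONS --safe #-}
module Submission where

-- Comparing coefficients in the generating function gives B_{k,n} = n! (X^k / k!) (Y^{n-k} / (n-k)!) with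
-- X = [x]_q and Y = [1-x]_q. Multiplied by (k choose i) / (n choose i), this becomes
-- (n-i)! X^i (X^{k-i} / (k-i)!) (Y^{n-k} / (n-k)!), so the sum over k is X^i (X + Y)^{n-i} by the binomial
-- theorem (the term k = i - 1 vanishes). It remains to see that X + Y > 0, i.e. q^x + q^{1-x} < 2.
-- With S = -log q > 0, a = x S and b = (1 - x) S, the inequality e^{-a} ≤ 1 / (1 + a) gives
-- 2 - e^{-a} - e^{-b} ≥ (S + 2 a b) / ((1 + a) (1 + b)), which is bounded away from 0.
-- As x is only known to lie in [0,1] up to an arbitrarily small error, and e^{-a} only through
-- partial sums, these estimates are made for rational approximations with explicit error terms.

open import Data.Nat.Base as ℕ using (ℕ; zero; suc; _∸_; _!)
import Data.Nat.Properties as ℕₚ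
open import Data.Nat.Combinatorics using (_C_; k![n∸k]!∣n!; nCk≡n!/k![n-k]!; k>n⇒nCk≡0)
open import Data.Nat.DivMod using (m/n*n≡m)
open import Data.Integer.Base as ℤ using (+_)
import Data.Integer.Properties as ℤₚ
open import Data.Rational.Base as ℚ using (ℚ; 0ℚ; 1ℚ; ½)
import Data.Rational.Properties as ℚₚ
import Data.Rational.Unnormalised.Base as ℚᵘ
import Data.Rational.Unnormalised.Properties as ℚᵘₚ
open import Data.Rational.Solver using (module +-*-Solver)
open import Data.Product.Base using (Σ-syntax; ∃; _×_; _,_; proj₁; proj₂)
open import Data.Bool.Base using (true; false; T)
open import Data.Sum.Base using (_⊎_; inj₁; inj₂)
open import Relation.Nullary using (contradiction)
open import Relation.Binary.PropositionalEquality using (_≡_; _≢_; refl; sym; trans; cong; cong₂; subst; module ≡-Reasoning)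
open import Defs

open +-*-Solver

-- Finite sums of rationals

sumℚ-cong : ∀ n {f g : ℕ → ℚ} → (∀ j → j ℕ.< n → f j ≡ g j) → sumℚ n f ≡ sumℚ n g
sumℚ-cong zero    h = refl
sumℚ-cong (suc n) h = cong₂ ℚ._+_ (sumℚ-cong n λ j p → h j (ℕₚ.m<n⇒m<1+n p)) (h n ℕₚ.≤-refl)

sumℚ-+ : ∀ n (f g : ℕ → ℚ) → sumℚ n (λ j → f j ℚ.+ g j) ≡ sumℚ n f ℚ.+ sumℚ n g
sumℚ-+ zero    f g = sym (ℚₚ.+-identityˡ 0ℚ)
sumℚ-+ (suc n) f g rewrite sumℚ-+ n f g =
  solve 4 (λ a b c d → (a :+ b) :+ (c :+ d) := (a :+ c) :+ (b :+ d)) refl (sumℚ n f) (sumℚ n g) (f n) (g n)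

sumℚ-*ˡ : ∀ c n (f : ℕ → ℚ) → sumℚ n (λ j → c ℚ.* f j) ≡ c ℚ.* sumℚ n f
sumℚ-*ˡ c zero    f = sym (ℚₚ.*-zeroʳ c)
sumℚ-*ˡ c (suc n) f rewrite sumℚ-*ˡ c n f = sym (ℚₚ.*-distribˡ-+ c (sumℚ n f) (f n))

sumℚ-suc : ∀ n (f : ℕ → ℚ) → sumℚ (suc n) f ≡ f 0 ℚ.+ sumℚ n (λ j → f (suc j))
sumℚ-suc n f = trans (sumℚ-split f 1 n) (cong (ℚ._+ sumℚ n (λ j → f (suc j))) (ℚₚ.+-identityˡ (f 0)))

sumℚ-mono : ∀ n {f g : ℕ → ℚ} → (∀ j → j ℕ.< n → f j ℚ.≤ g j) → sumℚ n f ℚ.≤ sumℚ n g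
sumℚ-mono zero    h = ℚₚ.≤-refl
sumℚ-mono (suc n) h = ℚₚ.+-mono-≤ (sumℚ-mono n λ j p → h j (ℕₚ.m<n⇒m<1+n p)) (h n ℕₚ.≤-refl)

sumℚ-nonneg : ∀ n {f : ℕ → ℚ} → (∀ j → 0ℚ ℚ.≤ f j) → 0ℚ ℚ.≤ sumℚ n f
sumℚ-nonneg zero    h = ℚₚ.≤-refl
sumℚ-nonneg (suc n) h = ℚₚ.+-mono-≤ (sumℚ-nonneg n h) (h n)

∣sumℚ∣≤ : ∀ n (f : ℕ → ℚ) → ℚ.∣ sumℚ n f ∣ ℚ.≤ sumℚ n (λ j → ℚ.∣ f j ∣)
∣sumℚ∣≤ zero    f = ℚₚ.≤-refl
∣sumℚ∣≤ (suc n) f = ℚₚ.≤-trans (ℚₚ.∣p+q∣≤∣p∣+∣q∣ (sumℚ n f) (f n)) (ℚₚ.+-monoˡ-≤ ℚ.∣ f n ∣ (∣sumℚ∣≤ n f))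

sumℚ-delta : ∀ {n k} (d g : ℕ → ℚ) → k ℕ.< n → d k ≡ 1ℚ → (∀ j → j ≢ k → d j ≡ 0ℚ) →
             sumℚ n (λ j → d j ℚ.* g j) ≡ g k
sumℚ-delta {suc n} {k} d g (ℕ.s≤s k≤n) dk dj with ℕₚ.m≤n⇒m<n∨m≡n k≤n
... | inj₁ k<n = trans (cong₂ ℚ._+_ (sumℚ-delta d g k<n dk dj)
                         (trans (cong (ℚ._* g n) (dj n (λ e → ℕₚ.<⇒≢ k<n (sym e)))) (ℚₚ.*-zeroˡ (g n))))
                       (ℚₚ.+-identityʳ (g k))
... | inj₂ refl = trans (cong₂ ℚ._+_ (vanish n ℕₚ.≤-refl) (trans (cong (ℚ._* g n) dk) (ℚₚ.*-identityˡ (g n))))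
                        (ℚₚ.+-identityˡ (g n))
  where
  vanish : ∀ m → m ℕ.≤ k → sumℚ m (λ j → d j ℚ.* g j) ≡ 0ℚ
  vanish zero    _ = refl
  vanish (suc m) p = trans (cong₂ ℚ._+_ (vanish m (ℕₚ.<⇒≤ p))
                       (trans (cong (ℚ._* g m) (dj m (ℕₚ.<⇒≢ p))) (ℚₚ.*-zeroˡ (g m)))) (ℚₚ.+-identityˡ 0ℚ)

-- Natural numbers as rationals

ι-+ : ∀ m n → ι (m ℕ.+ n) ≡ ι m ℚ.+ ι n
ι-+ zero    n = sym (ℚₚ.+-identityˡ (ι n))
ι-+ (suc m) n = begin
  ι (suc (m ℕ.+ n))        ≡⟨ ι-suc (m ℕ.+ n) ⟩
  1ℚ ℚ.+ ι (m ℕ.+ n)       ≡⟨ cong (1ℚ ℚ.+_) (ι-+ m n) ⟩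
  1ℚ ℚ.+ (ι m ℚ.+ ι n)     ≡⟨ ℚₚ.+-assoc 1ℚ (ι m) (ι n) ⟨
  1ℚ ℚ.+ ι m ℚ.+ ι n       ≡⟨ cong (ℚ._+ ι n) (ι-suc m) ⟨
  ι (suc m) ℚ.+ ι n        ∎
  where open ≡-Reasoning

ι-* : ∀ m n → ι (m ℕ.* n) ≡ ι m ℚ.* ι n
ι-* zero    n = sym (ℚₚ.*-zeroˡ (ι n))
ι-* (suc m) n = begin
  ι (n ℕ.+ m ℕ.* n)          ≡⟨ ι-+ n (m ℕ.* n) ⟩
  ι n ℚ.+ ι (m ℕ.* n)        ≡⟨ cong (ι n ℚ.+_) (ι-* m n) ⟩
  ι n ℚ.+ ι m ℚ.* ι n        ≡⟨ solve 2 (λ a b → b :+ a :* b := (con 1ℚ :+ a) :* b) refl (ι m) (ι n) ⟩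
  (1ℚ ℚ.+ ι m) ℚ.* ι n       ≡⟨ cong (ℚ._* ι n) (ι-suc m) ⟨
  ι (suc m) ℚ.* ι n          ∎
  where open ≡-Reasoning

/≡ι*1/ℕ : ∀ p d .{{_ : ℕ.NonZero d}} → + p ℚ./ d ≡ ι p ℚ.* 1/ℕ d
/≡ι*1/ℕ p (suc d) = ℚₚ.toℚᵘ-injective (ℚᵘₚ.≃-trans (ℚₚ.toℚᵘ-fromℚᵘ (ℚᵘ.mkℚᵘ (+ p) d))
  (ℚᵘₚ.≃-sym (ℚᵘₚ.≃-trans (ℚₚ.toℚᵘ-homo-* (ι p) (1/ℕ (suc d)))
    (ℚᵘₚ.≃-trans
      (ℚᵘₚ.*-cong (ℚₚ.toℚᵘ-fromℚᵘ (ℚᵘ.mkℚᵘ (+ p) 0)) (ℚₚ.toℚᵘ-fromℚᵘ (ℚᵘ.mkℚᵘ (+ 1) d)))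
      (ℚᵘ.*≡* (cong₂ ℤ._*_ (ℤₚ.*-identityʳ (+ p)) (cong +_ (sym (ℕₚ.*-identityˡ (suc d))))))))))

-- The terms of the exponential series

1/!ℚ : ℕ → ℚ
1/!ℚ k = 1/ℕ (k !) {{k ℕₚ.!≢0}}

!*1/! : ∀ k → ι (k !) ℚ.* 1/!ℚ k ≡ 1ℚ
!*1/! k = ι*1/ℕ (k !) {{k ℕₚ.!≢0}}

0≤1/! : ∀ k → 0ℚ ℚ.≤ 1/!ℚ k
0≤1/! k = ℚₚ.<⇒≤ (0<1/ℕ (k !) {{k ℕₚ.!≢0}})

expTermℚ : ℚ → ℕ → ℚ
expTermℚ u k = u ^ℚ k ℚ.* 1/!ℚ k

-- Coefficient form of the differential equation of `e^{ut}`; it drives the induction for the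
-- binomial theorem.
expTermℚ-suc : ∀ u k → ι (suc k) ℚ.* expTermℚ u (suc k) ≡ u ℚ.* expTermℚ u k
expTermℚ-suc u k = begin
  ι (suc k) ℚ.* (u ℚ.* u ^ℚ k ℚ.* 1/!ℚ (suc k))
    ≡⟨ cong (λ t → ι (suc k) ℚ.* (u ℚ.* u ^ℚ k ℚ.* t)) (1/ℕ-* (suc k) (k !) {{_}} {{k ℕₚ.!≢0}} {{suc k ℕₚ.!≢0}}) ⟩
  ι (suc k) ℚ.* (u ℚ.* u ^ℚ k ℚ.* (1/ℕ (suc k) ℚ.* 1/!ℚ k))
    ≡⟨ solve 5 (λ i u p d w → i :* (u :* p :* (d :* w)) := (i :* d) :* (u :* (p :* w))) refl (ι (suc k)) u (u ^ℚ k) (1/ℕ (suc k)) (1/!ℚ k) ⟩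
  (ι (suc k) ℚ.* 1/ℕ (suc k)) ℚ.* (u ℚ.* expTermℚ u k)
    ≡⟨ cong (ℚ._* (u ℚ.* expTermℚ u k)) (ι*1/ℕ (suc k)) ⟩
  1ℚ ℚ.* (u ℚ.* expTermℚ u k)
    ≡⟨ ℚₚ.*-identityˡ _ ⟩
  u ℚ.* expTermℚ u k ∎
  where open ≡-Reasoning

ι-suc-cancelˡ : ∀ m {a b} → ι (suc m) ℚ.* a ≡ ι (suc m) ℚ.* b → a ≡ b
ι-suc-cancelˡ m {a} {b} h = trans (sym (undo a)) (trans (cong (1/ℕ (suc m) ℚ.*_) h) (undo b))
  where
  undo : ∀ c → 1/ℕ (suc m) ℚ.* (ι (suc m) ℚ.* c) ≡ c
  undo c = trans (solve 3 (λ d i c → d :* (i :* c) := (i :* d) :* c) refl (1/ℕ (suc m)) (ι (suc m)) c)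
    (trans (cong (ℚ._* c) (ι*1/ℕ (suc m))) (ℚₚ.*-identityˡ c))

-- The binomial theorem, divided by m!.
expTermℚ-+ : ∀ u v m → sumℚ (suc m) (λ j → expTermℚ u j ℚ.* expTermℚ v (m ∸ j)) ≡ expTermℚ (u ℚ.+ v) m
expTermℚ-+ u v zero    = refl
expTermℚ-+ u v (suc m) = ι-suc-cancelˡ m (begin
  ι (suc m) ℚ.* sumℚ (suc (suc m)) (λ j → e j ℚ.* f (suc m ∸ j))
    ≡⟨ sumℚ-*ˡ (ι (suc m)) (suc (suc m)) _ ⟨
  sumℚ (suc (suc m)) (λ j → ι (suc m) ℚ.* (e j ℚ.* f (suc m ∸ j)))
    ≡⟨ sumℚ-cong (suc (suc m)) split ⟩
  sumℚ (suc (suc m)) (λ j → L j ℚ.+ R j)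
    ≡⟨ sumℚ-+ (suc (suc m)) L R ⟩
  sumℚ (suc (suc m)) L ℚ.+ sumℚ (suc (suc m)) R
    ≡⟨ cong₂ ℚ._+_ sumL sumR ⟩
  u ℚ.* S ℚ.+ v ℚ.* S
    ≡⟨ ℚₚ.*-distribʳ-+ S u v ⟨
  (u ℚ.+ v) ℚ.* S
    ≡⟨ cong ((u ℚ.+ v) ℚ.*_) (expTermℚ-+ u v m) ⟩
  (u ℚ.+ v) ℚ.* expTermℚ (u ℚ.+ v) m
    ≡⟨ expTermℚ-suc (u ℚ.+ v) m ⟨
  ι (suc m) ℚ.* expTermℚ (u ℚ.+ v) (suc m) ∎)
  where
  open ≡-Reasoning
  e f L R : ℕ → ℚ
  e = expTermℚ u
  f = expTermℚ v
  -- Product rule: the factor m + 1 is split as j + (m + 1 - j), and each part lowers the index of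
  -- one factor. The end terms `L 0` and `R (suc m)` vanish because they contain `ι 0`.
  L j = (ι j ℚ.* e j) ℚ.* f (suc m ∸ j)
  R j = e j ℚ.* (ι (suc m ∸ j) ℚ.* f (suc m ∸ j))
  S : ℚ
  S = sumℚ (suc m) (λ j → e j ℚ.* f (m ∸ j))
  split : ∀ j → j ℕ.< suc (suc m) → ι (suc m) ℚ.* (e j ℚ.* f (suc m ∸ j)) ≡ L j ℚ.+ R j
  split j (ℕ.s≤s j≤) = trans
    (cong (ℚ._* (e j ℚ.* f (suc m ∸ j))) (trans (cong ι (sym (ℕₚ.m+[n∸m]≡n j≤))) (ι-+ j (suc m ∸ j))))
    (solve 4 (λ a b e f → (a :+ b) :* (e :* f) := (a :* e) :* f :+ e :* (b :* f)) refl (ι j) (ι (suc m ∸ j)) (e j) (f (suc m ∸ j)))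
  sumL : sumℚ (suc (suc m)) L ≡ u ℚ.* S
  sumL = begin
    sumℚ (suc (suc m)) L
      ≡⟨ sumℚ-suc (suc m) L ⟩
    (0ℚ ℚ.* e 0) ℚ.* f (suc m) ℚ.+ sumℚ (suc m) (λ j → L (suc j))
      ≡⟨ solve 3 (λ a b s → (con 0ℚ :* a) :* b :+ s := s) refl (e 0) (f (suc m)) _ ⟩
    sumℚ (suc m) (λ j → L (suc j))
      ≡⟨ sumℚ-cong (suc m) (λ j _ → trans (cong (ℚ._* f (m ∸ j)) (expTermℚ-suc u j)) (ℚₚ.*-assoc u _ _)) ⟩
    sumℚ (suc m) (λ j → u ℚ.* (e j ℚ.* f (m ∸ j)))
      ≡⟨ sumℚ-*ˡ u (suc m) _ ⟩
    u ℚ.* S ∎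
  sumR : sumℚ (suc (suc m)) R ≡ v ℚ.* S
  sumR = begin
    sumℚ (suc m) R ℚ.+ e (suc m) ℚ.* (ι (m ∸ m) ℚ.* f (m ∸ m))
      ≡⟨ cong (λ t → sumℚ (suc m) R ℚ.+ e (suc m) ℚ.* (ι t ℚ.* f t)) (ℕₚ.n∸n≡0 m) ⟩
    sumℚ (suc m) R ℚ.+ e (suc m) ℚ.* (0ℚ ℚ.* f 0)
      ≡⟨ solve 3 (λ a b s → s :+ a :* (con 0ℚ :* b) := s) refl (e (suc m)) (f 0) (sumℚ (suc m) R) ⟩
    sumℚ (suc m) R
      ≡⟨ sumℚ-cong (suc m) (λ j j≤m → R≡ j (ℕ.s≤s⁻¹ j≤m)) ⟩
    sumℚ (suc m) (λ j → v ℚ.* (e j ℚ.* f (m ∸ j)))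
      ≡⟨ sumℚ-*ˡ v (suc m) _ ⟩
    v ℚ.* S ∎
    where
    R≡ : ∀ j → j ℕ.≤ m → R j ≡ v ℚ.* (e j ℚ.* f (m ∸ j))
    R≡ j j≤m rewrite ℕₚ.+-∸-assoc 1 j≤m = trans (cong (e j ℚ.*_) (expTermℚ-suc v (m ∸ j)))
      (solve 3 (λ e v f → e :* (v :* f) := v :* (e :* f)) refl (e j) v (f (m ∸ j)))

-- Binomial coefficients as factorials, and the Bernstein sum

nCk*[k!*[n∸k]!]≡n! : ∀ {n k} → k ℕ.≤ n → (n C k) ℕ.* (k ! ℕ.* (n ∸ k) !) ≡ n !
nCk*[k!*[n∸k]!]≡n! {n} {k} k≤n = trans (cong (ℕ._* (k ! ℕ.* (n ∸ k) !)) (nCk≡n!/k![n-k]! k≤n))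
  (m/n*n≡m {{k ℕₚ.!* (n ∸ k) !≢0}} (k![n∸k]!∣n! k≤n))

[k+l]Ck : ∀ k l → ι ((k ℕ.+ l) C k) ℚ.* (ι (k !) ℚ.* ι (l !)) ≡ ι ((k ℕ.+ l) !)
[k+l]Ck k l = begin
  ι c ℚ.* (ι (k !) ℚ.* ι (l !))      ≡⟨ cong (ι c ℚ.*_) (ι-* (k !) (l !)) ⟨
  ι c ℚ.* ι (k ! ℕ.* l !)            ≡⟨ ι-* c (k ! ℕ.* l !) ⟨
  ι (c ℕ.* (k ! ℕ.* l !))            ≡⟨ cong (λ t → ι (c ℕ.* (k ! ℕ.* t !))) (ℕₚ.m+n∸m≡n k l) ⟨
  ι (c ℕ.* (k ! ℕ.* (k ℕ.+ l ∸ k) !)) ≡⟨ cong ι (nCk*[k!*[n∸k]!]≡n! (ℕₚ.m≤m+n k l)) ⟩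
  ι ((k ℕ.+ l) !)                    ∎
  where
  open ≡-Reasoning
  c : ℕ
  c = (k ℕ.+ l) C k

-- (k choose i) / (n choose i) · n! / k! = (n - i)! / (k - i)!, for k = i + l and n = i + p.
ratio-factorials : ∀ i l p .{{_ : ℕ.NonZero ((i ℕ.+ p) C i)}} →
  (+ ((i ℕ.+ l) C i) ℚ./ ((i ℕ.+ p) C i)) ℚ.* (ι ((i ℕ.+ p) !) ℚ.* 1/!ℚ (i ℕ.+ l)) ≡ ι (p !) ℚ.* 1/!ℚ l
ratio-factorials i l p = begin
  (+ ((i ℕ.+ l) C i) ℚ./ ((i ℕ.+ p) C i)) ℚ.* (ι ((i ℕ.+ p) !) ℚ.* wk)
    ≡⟨ cong₂ (λ s t → s ℚ.* (t ℚ.* wk)) (/≡ι*1/ℕ ((i ℕ.+ l) C i) ((i ℕ.+ p) C i)) (sym ([k+l]Ck i p)) ⟩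
  (ck ℚ.* dn) ℚ.* ((cn ℚ.* (fi ℚ.* fp)) ℚ.* wk)
    ≡⟨ solve 6 (λ ck dn cn fi fp wk → (ck :* dn) :* ((cn :* (fi :* fp)) :* wk) := (cn :* dn) :* ((ck :* fi) :* (fp :* wk))) refl ck dn cn fi fp wk ⟩
  (cn ℚ.* dn) ℚ.* ((ck ℚ.* fi) ℚ.* (fp ℚ.* wk))
    -- The factor `fl ℚ.* wl`, equal to 1, is inserted so that `ck ℚ.* (fi ℚ.* fl)` can be collapsed
    -- to a factorial.
    ≡⟨ cong₂ (λ s t → s ℚ.* ((ck ℚ.* fi) ℚ.* t)) (ι*1/ℕ ((i ℕ.+ p) C i)) (sym (trans (cong ((fp ℚ.* wk) ℚ.*_) (!*1/! l)) (ℚₚ.*-identityʳ _))) ⟩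
  1ℚ ℚ.* ((ck ℚ.* fi) ℚ.* ((fp ℚ.* wk) ℚ.* (fl ℚ.* wl)))
    ≡⟨ solve 6 (λ ck fi fp wk fl wl → con 1ℚ :* ((ck :* fi) :* ((fp :* wk) :* (fl :* wl))) := ((ck :* (fi :* fl)) :* wk) :* (fp :* wl)) refl ck fi fp wk fl wl ⟩
  ((ck ℚ.* (fi ℚ.* fl)) ℚ.* wk) ℚ.* (fp ℚ.* wl)
    ≡⟨ cong (λ t → (t ℚ.* wk) ℚ.* (fp ℚ.* wl)) ([k+l]Ck i l) ⟩
  (ι ((i ℕ.+ l) !) ℚ.* wk) ℚ.* (fp ℚ.* wl)
    ≡⟨ cong (ℚ._* (fp ℚ.* wl)) (!*1/! (i ℕ.+ l)) ⟩
  1ℚ ℚ.* (fp ℚ.* wl)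
    ≡⟨ ℚₚ.*-identityˡ _ ⟩
  fp ℚ.* wl ∎
  where
  open ≡-Reasoning
  ck dn cn fi fp fl wk wl : ℚ
  ck = ι ((i ℕ.+ l) C i)
  cn = ι ((i ℕ.+ p) C i)
  dn = 1/ℕ ((i ℕ.+ p) C i)
  fi = ι (i !)
  fp = ι (p !)
  fl = ι (l !)
  wk = 1/!ℚ (i ℕ.+ l)
  wl = 1/!ℚ l

-- With k = i + l and n = i + p, the factor p! X^i does not depend on l. What remains is the Cauchy
-- product evaluated by `expTermℚ-+`, whose 1 / p! cancels p!.
bernstein-sum : ∀ X Y i p .{{_ : ℕ.NonZero ((i ℕ.+ p) C i)}} →
  sumℚ (suc p) (λ l → (+ ((i ℕ.+ l) C i) ℚ./ ((i ℕ.+ p) C i)) ℚ.*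
    (ι ((i ℕ.+ p) !) ℚ.* (expTermℚ X (i ℕ.+ l) ℚ.* expTermℚ Y (p ∸ l))))
  ≡ (X ℚ.+ Y) ^ℚ p ℚ.* X ^ℚ i
bernstein-sum X Y i p = begin
  sumℚ (suc p) _
    ≡⟨ sumℚ-cong (suc p) (λ l _ → term l) ⟩
  sumℚ (suc p) (λ l → (ι (p !) ℚ.* X ^ℚ i) ℚ.* (expTermℚ X l ℚ.* expTermℚ Y (p ∸ l)))
    ≡⟨ sumℚ-*ˡ (ι (p !) ℚ.* X ^ℚ i) (suc p) _ ⟩
  (ι (p !) ℚ.* X ^ℚ i) ℚ.* sumℚ (suc p) (λ l → expTermℚ X l ℚ.* expTermℚ Y (p ∸ l))
    ≡⟨ cong ((ι (p !) ℚ.* X ^ℚ i) ℚ.*_) (expTermℚ-+ X Y p) ⟩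
  (ι (p !) ℚ.* X ^ℚ i) ℚ.* ((X ℚ.+ Y) ^ℚ p ℚ.* 1/!ℚ p)
    ≡⟨ solve 4 (λ f x z w → (f :* x) :* (z :* w) := (f :* w) :* (z :* x)) refl (ι (p !)) (X ^ℚ i) ((X ℚ.+ Y) ^ℚ p) (1/!ℚ p) ⟩
  (ι (p !) ℚ.* 1/!ℚ p) ℚ.* ((X ℚ.+ Y) ^ℚ p ℚ.* X ^ℚ i)
    ≡⟨ trans (cong (ℚ._* ((X ℚ.+ Y) ^ℚ p ℚ.* X ^ℚ i)) (!*1/! p)) (ℚₚ.*-identityˡ _) ⟩
  (X ℚ.+ Y) ^ℚ p ℚ.* X ^ℚ i ∎
  where
  open ≡-Reasoning
  term : ∀ l → (+ ((i ℕ.+ l) C i) ℚ./ ((i ℕ.+ p) C i)) ℚ.*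
      (ι ((i ℕ.+ p) !) ℚ.* (expTermℚ X (i ℕ.+ l) ℚ.* expTermℚ Y (p ∸ l)))
    ≡ (ι (p !) ℚ.* X ^ℚ i) ℚ.* (expTermℚ X l ℚ.* expTermℚ Y (p ∸ l))
  term l = begin
    c ℚ.* (N ℚ.* ((X ^ℚ (i ℕ.+ l) ℚ.* w) ℚ.* y))
      ≡⟨ cong (λ t → c ℚ.* (N ℚ.* ((t ℚ.* w) ℚ.* y))) (^-+ X i l) ⟩
    c ℚ.* (N ℚ.* (((X ^ℚ i ℚ.* X ^ℚ l) ℚ.* w) ℚ.* y))
      ≡⟨ solve 6 (λ c n a b w y → c :* (n :* (((a :* b) :* w) :* y)) := (c :* (n :* w)) :* (a :* (b :* y))) refl c N (X ^ℚ i) (X ^ℚ l) w y ⟩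
    (c ℚ.* (N ℚ.* w)) ℚ.* (X ^ℚ i ℚ.* (X ^ℚ l ℚ.* y))
      ≡⟨ cong (ℚ._* (X ^ℚ i ℚ.* (X ^ℚ l ℚ.* y))) (ratio-factorials i l p) ⟩
    (ι (p !) ℚ.* 1/!ℚ l) ℚ.* (X ^ℚ i ℚ.* (X ^ℚ l ℚ.* y))
      ≡⟨ solve 5 (λ f w a b y → (f :* w) :* (a :* (b :* y)) := (f :* a) :* ((b :* w) :* y)) refl (ι (p !)) (1/!ℚ l) (X ^ℚ i) (X ^ℚ l) y ⟩
    (ι (p !) ℚ.* X ^ℚ i) ℚ.* ((X ^ℚ l ℚ.* 1/!ℚ l) ℚ.* y) ∎
    where
    c N w y : ℚ
    c = + ((i ℕ.+ l) C i) ℚ./ ((i ℕ.+ p) C i)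
    N = ι ((i ℕ.+ p) !)
    w = 1/!ℚ (i ℕ.+ l)
    y = expTermℚ Y (p ∸ l)

-- Inequalities between rationals

0≤q-p⇒p≤q : ∀ {p q} → 0ℚ ℚ.≤ q ℚ.- p → p ℚ.≤ q
0≤q-p⇒p≤q {p} {q} h = subst₂≤ (ℚₚ.+-identityˡ p) (solve 2 (λ p q → (q :- p) :+ p := q) refl p q) (ℚₚ.+-monoˡ-≤ p h)

+-nonneg : ∀ {a b} → 0ℚ ℚ.≤ a → 0ℚ ℚ.≤ b → 0ℚ ℚ.≤ a ℚ.+ b
+-nonneg = ℚₚ.+-mono-≤

½*-pos : ∀ {ε} → 0ℚ ℚ.< ε → 0ℚ ℚ.< ½ ℚ.* ε
½*-pos = *-pos 0<½

½*-< : ∀ {ε} → 0ℚ ℚ.< ε → ½ ℚ.* ε ℚ.< ε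
½*-< {ε} 0<ε = <ˡ (ℚₚ.+-identityˡ (½ ℚ.* ε))
  (<ʳ (solve 1 (λ e → con ½ :* e :+ con ½ :* e := e) refl ε) (ℚₚ.+-monoˡ-< (½ ℚ.* ε) (½*-pos 0<ε)))

scale : ∀ {M ε} → 0ℚ ℚ.< M → 0ℚ ℚ.< ε → ∃ λ δ → 0ℚ ℚ.< δ × M ℚ.* δ ≡ ε
scale {M} {ε} 0<M 0<ε = let D , 0<D , DM = recip 0<M in
  D ℚ.* ε , *-pos 0<D 0<ε ,
  trans (solve 3 (λ m d e → m :* (d :* e) := (d :* m) :* e) refl M D ε) (trans (cong (ℚ._* ε) DM) (ℚₚ.*-identityˡ ε))

∣*∣≤ : ∀ a b {c d} → ℚ.∣ a ∣ ℚ.≤ c → ℚ.∣ b ∣ ℚ.≤ d → ℚ.∣ a ℚ.* b ∣ ℚ.≤ c ℚ.* d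
∣*∣≤ a b h k = ≤ˡ (sym (ℚₚ.∣p*q∣≡∣p∣*∣q∣ a b)) (*-mono (ℚₚ.0≤∣p∣ a) h (ℚₚ.0≤∣p∣ b) k)

-- Equality of reals is a congruence

-- Permits a constant factor and a non-strict bound in estimates; aiming at half of ε restores
-- strictness.
≈-intro : ∀ {x y} M → 0ℚ ℚ.< M →
  (∀ ε → 0ℚ ℚ.< ε → ∃ λ N → ∀ n → N ℕ.≤ n → ℚ.∣ seq x n ℚ.- seq y n ∣ ℚ.≤ M ℚ.* ε) → x ≈ y
≈-intro M 0<M H ε 0<ε =
  let δ , 0<δ , Mδ = scale 0<M (½*-pos 0<ε)
      N , h = H δ 0<δ
  in N , λ n p → ℚₚ.≤-<-trans (≤ʳ Mδ (h n p)) (½*-< 0<ε)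

eventually-≡⇒≈ : ∀ {x y} N → (∀ n → N ℕ.≤ n → seq x n ≡ seq y n) → x ≈ y
eventually-≡⇒≈ {x} {y} N h ε 0<ε = N , λ n p →
  subst (λ t → ℚ.∣ t ∣ ℚ.< ε) (sym (trans (cong (ℚ._- seq y n) (h n p)) (ℚₚ.+-inverseʳ (seq y n)))) 0<ε

≈-sym : ∀ {x y} → x ≈ y → y ≈ x
≈-sym {x} {y} h ε 0<ε = let N , k = h ε 0<ε in N , λ n p → <ˡ (∣-∣-sym (seq x n) (seq y n)) (k n p)

0<2 : 0ℚ ℚ.< 1ℚ ℚ.+ 1ℚ
0<2 = +-pos 0≤1 0<1

≈-trans : ∀ {x y z} → x ≈ y → y ≈ z → x ≈ z
≈-trans {x} {y} {z} h k = ≈-intro {x} {z} (1ℚ ℚ.+ 1ℚ) 0<2 λ ε 0<ε →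
  let N₁ , h₁ = h ε 0<ε
      N₂ , h₂ = k ε 0<ε
  in N₁ ℕ.⊔ N₂ , λ n p → ℚₚ.≤-trans (triangle (seq x n) (seq y n) (seq z n))
    (≤ʳ (solve 1 (λ e → e :+ e := (con 1ℚ :+ con 1ℚ) :* e) refl ε)
      (ℚₚ.+-mono-≤ (ℚₚ.<⇒≤ (h₁ n (ℕₚ.m⊔n≤o⇒m≤o N₁ N₂ p))) (ℚₚ.<⇒≤ (h₂ n (ℕₚ.m⊔n≤o⇒n≤o N₁ N₂ p)))))

+-cong : ∀ {x x′ y y′} → x ≈ x′ → y ≈ y′ → x + y ≈ x′ + y′
+-cong {x} {x′} {y} {y′} h k = ≈-intro {x + y} {x′ + y′} (1ℚ ℚ.+ 1ℚ) 0<2 λ ε 0<ε →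
  let N₁ , h₁ = h ε 0<ε
      N₂ , h₂ = k ε 0<ε
  in N₁ ℕ.⊔ N₂ , λ n p → subst₂≤
    (cong ℚ.∣_∣ (solve 4 (λ a b c d → (a :- c) :+ (b :- d) := (a :+ b) :- (c :+ d)) refl (seq x n) (seq y n) (seq x′ n) (seq y′ n)))
    (solve 1 (λ e → e :+ e := (con 1ℚ :+ con 1ℚ) :* e) refl ε)
    (ℚₚ.≤-trans (ℚₚ.∣p+q∣≤∣p∣+∣q∣ (seq x n ℚ.- seq x′ n) (seq y n ℚ.- seq y′ n))
      (ℚₚ.+-mono-≤ (ℚₚ.<⇒≤ (h₁ n (ℕₚ.m⊔n≤o⇒m≤o N₁ N₂ p))) (ℚₚ.<⇒≤ (h₂ n (ℕₚ.m⊔n≤o⇒n≤o N₁ N₂ p)))))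

*-congˡ : ∀ x {y z} → y ≈ z → x * y ≈ x * z
*-congˡ x {y} {z} h =
  let M , 0<M , K , bd = bounded (cauchy x)
  in ≈-intro {x * y} {x * z} M 0<M λ ε 0<ε →
  let N , k = h ε 0<ε
  in K ℕ.⊔ N , λ n p → ≤ˡ
    (cong ℚ.∣_∣ (solve 3 (λ a b c → a :* (b :- c) := a :* b :- a :* c) refl (seq x n) (seq y n) (seq z n)))
    (∣*∣≤ (seq x n) (seq y n ℚ.- seq z n) (bd n (ℕₚ.m⊔n≤o⇒m≤o K N p)) (ℚₚ.<⇒≤ (k n (ℕₚ.m⊔n≤o⇒n≤o K N p))))

sum-cong : ∀ n {f g : ℕ → ℝ} → (∀ j → f j ≈ g j) → sum n f ≈ sum n g
sum-cong zero    h = eventually-≡⇒≈ {0ℝ} {0ℝ} 0 λ _ _ → refl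
sum-cong (suc n) {f} {g} h = +-cong {sum n f} {sum n g} {f n} {g n} (sum-cong n h) (h n)

-- Partial sums of the exponential series

expℚ : ℕ → ℚ → ℚ
expℚ m u = sumℚ m (expTermℚ u)

-- The truncation index and the argument vary together with m, so the estimates on `expℚ m u` below
-- have to be uniform in u.
seq-exp : ∀ x m → seq (exp x) m ≡ expℚ m (seq x m)
seq-exp x m = sumℚ-cong m λ k _ → cong (ℚ._* 1/!ℚ k) (seq-^ x k m)

expTermℚ-nonneg : ∀ {u} → 0ℚ ℚ.≤ u → ∀ k → 0ℚ ℚ.≤ expTermℚ u k
expTermℚ-nonneg 0≤u k = *-nonneg (^-nonneg 0≤u k) (0≤1/! k)

∣expTermℚ∣≤ : ∀ {u R} → ℚ.∣ u ∣ ℚ.≤ R → ∀ k → ℚ.∣ expTermℚ u k ∣ ℚ.≤ expTermℚ R k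
∣expTermℚ∣≤ {u} h k = ∣*∣≤ (u ^ℚ k) (1/!ℚ k) (∣^∣≤ h k) (ℚₚ.≤-reflexive (ℚₚ.0≤p⇒∣p∣≡p (0≤1/! k)))

expℚ-tail : ∀ u k l → expℚ (k ℕ.+ l) u ℚ.- expℚ k u ≡ sumℚ l (λ j → expTermℚ u (k ℕ.+ j))
expℚ-tail u k l = trans (cong (ℚ._- expℚ k u) (sumℚ-split (expTermℚ u) k l))
  (solve 2 (λ a b → (a :+ b) :- a := b) refl (expℚ k u) _)

expℚ-mono : ∀ {u} → 0ℚ ℚ.≤ u → ∀ {k m} → k ℕ.≤ m → expℚ k u ℚ.≤ expℚ m u
expℚ-mono {u} 0≤u {k} k≤m with ℕₚ.m≤n⇒∃[o]m+o≡n k≤m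
... | l , refl = 0≤q-p⇒p≤q (≤ʳ (sym (expℚ-tail u k l)) (sumℚ-nonneg l λ j → expTermℚ-nonneg 0≤u (k ℕ.+ j)))

∣expℚ-tail∣≤ : ∀ {u R} → ℚ.∣ u ∣ ℚ.≤ R → ∀ {k m} → k ℕ.≤ m →
               ℚ.∣ expℚ m u ℚ.- expℚ k u ∣ ℚ.≤ expℚ m R ℚ.- expℚ k R
∣expℚ-tail∣≤ {u} {R} h {k} k≤m with ℕₚ.m≤n⇒∃[o]m+o≡n k≤m
... | l , refl = subst₂≤ (cong ℚ.∣_∣ (sym (expℚ-tail u k l))) (sym (expℚ-tail R k l))
  (ℚₚ.≤-trans (∣sumℚ∣≤ l _) (sumℚ-mono l λ j _ → ∣expTermℚ∣≤ h (k ℕ.+ j)))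

-- The left side sums the Cauchy product over the triangle j + l < m. Passing to m + 1 adds the
-- diagonal j + l = m, which `expTermℚ-+` evaluates.
expℚ-+ : ∀ u v m → sumℚ m (λ j → expTermℚ u j ℚ.* expℚ (m ∸ j) v) ≡ expℚ m (u ℚ.+ v)
expℚ-+ u v zero    = refl
expℚ-+ u v (suc m) = begin
  sumℚ (suc m) (λ j → e j ℚ.* expℚ (suc m ∸ j) v)
    ≡⟨ sumℚ-cong (suc m) (λ j j≤m → split j (ℕ.s≤s⁻¹ j≤m)) ⟩
  sumℚ (suc m) (λ j → L j ℚ.+ R j)
    ≡⟨ sumℚ-+ (suc m) L R ⟩
  (sumℚ m L ℚ.+ e m ℚ.* expℚ (m ∸ m) v) ℚ.+ sumℚ (suc m) R
    ≡⟨ cong₂ (λ s t → (s ℚ.+ e m ℚ.* expℚ t v) ℚ.+ sumℚ (suc m) R) (expℚ-+ u v m) (ℕₚ.n∸n≡0 m) ⟩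
  (expℚ m (u ℚ.+ v) ℚ.+ e m ℚ.* 0ℚ) ℚ.+ sumℚ (suc m) R
    ≡⟨ cong₂ ℚ._+_ (solve 2 (λ a b → a :+ b :* con 0ℚ := a) refl (expℚ m (u ℚ.+ v)) (e m)) (expTermℚ-+ u v m) ⟩
  expℚ (suc m) (u ℚ.+ v) ∎
  where
  open ≡-Reasoning
  e L R : ℕ → ℚ
  e = expTermℚ u
  L j = e j ℚ.* expℚ (m ∸ j) v
  R j = e j ℚ.* expTermℚ v (m ∸ j)
  split : ∀ j → j ℕ.≤ m → e j ℚ.* expℚ (suc m ∸ j) v ≡ L j ℚ.+ R j
  split j j≤m rewrite ℕₚ.+-∸-assoc 1 j≤m = ℚₚ.*-distribˡ-+ (e j) _ _

-- The error consists of the terms of index ≥ m in the Cauchy product, which are dominated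
-- by terms of the tail of the series for e^{2R}.
expℚ-*-error : ∀ {u v R} → ℚ.∣ u ∣ ℚ.≤ R → ℚ.∣ v ∣ ℚ.≤ R → ∀ m →
  ℚ.∣ expℚ m u ℚ.* expℚ m v ℚ.- expℚ m (u ℚ.+ v) ∣ ℚ.≤ expℚ (m ℕ.+ m) (R ℚ.+ R) ℚ.- expℚ m (R ℚ.+ R)
expℚ-*-error {u} {v} {R} hu hv m = begin
  ℚ.∣ expℚ m u ℚ.* expℚ m v ℚ.- expℚ m (u ℚ.+ v) ∣
    ≡⟨ cong ℚ.∣_∣ error≡ ⟩
  ℚ.∣ sumℚ m (λ j → expTermℚ u j ℚ.* (expℚ m v ℚ.- expℚ (m ∸ j) v)) ∣
    ≤⟨ ∣sumℚ∣≤ m _ ⟩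
  sumℚ m (λ j → ℚ.∣ expTermℚ u j ℚ.* (expℚ m v ℚ.- expℚ (m ∸ j) v) ∣)
    ≤⟨ sumℚ-mono m (λ j j<m → ∣*∣≤ (expTermℚ u j) (expℚ m v ℚ.- expℚ (m ∸ j) v) (∣expTermℚ∣≤ hu j) (tail≤ j (ℕₚ.<⇒≤ j<m))) ⟩
  -- The upper limit of the inner tail has been raised from m to 2m - j. The sum thereby becomes
  -- part of the triangle j + l < 2m, and adding the nonnegative terms with j ≥ m completes it, so
  -- that `expℚ-+` applies.
  sumℚ m (λ j → e j ℚ.* (expℚ (m ℕ.+ m ∸ j) R ℚ.- expℚ (m ∸ j) R))
    ≡⟨ sumℚ-*-minus e (λ j → expℚ (m ℕ.+ m ∸ j) R) (λ j → expℚ (m ∸ j) R) m ⟩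
  sumℚ m F ℚ.- sumℚ m (λ j → e j ℚ.* expℚ (m ∸ j) R)
    ≡⟨ cong (λ t → sumℚ m F ℚ.- t) (expℚ-+ R R m) ⟩
  sumℚ m F ℚ.- expℚ m (R ℚ.+ R)
    ≤⟨ ℚₚ.+-monoˡ-≤ (ℚ.- expℚ m (R ℚ.+ R)) more ⟩
  sumℚ (m ℕ.+ m) F ℚ.- expℚ m (R ℚ.+ R)
    ≡⟨ cong (ℚ._- expℚ m (R ℚ.+ R)) (expℚ-+ R R (m ℕ.+ m)) ⟩
  expℚ (m ℕ.+ m) (R ℚ.+ R) ℚ.- expℚ m (R ℚ.+ R) ∎
  where
  open ℚₚ.≤-Reasoning
  0≤R : 0ℚ ℚ.≤ R
  0≤R = ℚₚ.≤-trans (ℚₚ.0≤∣p∣ u) hu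
  e F : ℕ → ℚ
  e = expTermℚ R
  F j = e j ℚ.* expℚ (m ℕ.+ m ∸ j) R
  sumℚ-*-minus : ∀ (a b c : ℕ → ℚ) n →
    sumℚ n (λ j → a j ℚ.* (b j ℚ.- c j)) ≡ sumℚ n (λ j → a j ℚ.* b j) ℚ.- sumℚ n (λ j → a j ℚ.* c j)
  sumℚ-*-minus a b c zero    = refl
  sumℚ-*-minus a b c (suc n) rewrite sumℚ-*-minus a b c n =
    solve 5 (λ s t a b c → (s :- t) :+ a :* (b :- c) := (s :+ a :* b) :- (t :+ a :* c)) refl
      (sumℚ n (λ j → a j ℚ.* b j)) (sumℚ n (λ j → a j ℚ.* c j)) (a n) (b n) (c n)
  error≡ : expℚ m u ℚ.* expℚ m v ℚ.- expℚ m (u ℚ.+ v) ≡ sumℚ m (λ j → expTermℚ u j ℚ.* (expℚ m v ℚ.- expℚ (m ∸ j) v))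
  error≡ = sym (trans (sumℚ-*-minus (expTermℚ u) (λ _ → expℚ m v) (λ j → expℚ (m ∸ j) v) m)
    (cong₂ ℚ._-_
      (trans (sumℚ-cong m (λ j _ → ℚₚ.*-comm (expTermℚ u j) (expℚ m v)))
        (trans (sumℚ-*ˡ (expℚ m v) m (expTermℚ u)) (ℚₚ.*-comm (expℚ m v) (expℚ m u))))
      (expℚ-+ u v m)))
  tail≤ : ∀ j → j ℕ.≤ m → ℚ.∣ expℚ m v ℚ.- expℚ (m ∸ j) v ∣ ℚ.≤ expℚ (m ℕ.+ m ∸ j) R ℚ.- expℚ (m ∸ j) R
  tail≤ j j≤m = ℚₚ.≤-trans (∣expℚ-tail∣≤ hv (ℕₚ.m∸n≤m m j))
    (ℚₚ.+-monoˡ-≤ (ℚ.- expℚ (m ∸ j) R) (expℚ-mono 0≤R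
      (subst (m ℕ.≤_) (sym (ℕₚ.+-∸-assoc m j≤m)) (ℕₚ.m≤m+n m (m ∸ j)))))
  more : sumℚ m F ℚ.≤ sumℚ (m ℕ.+ m) F
  more = ≤ʳ (sym (sumℚ-split F m m)) (≤ˡ (ℚₚ.+-identityʳ (sumℚ m F)) (ℚₚ.+-monoʳ-≤ (sumℚ m F)
    (sumℚ-nonneg m λ j → *-nonneg (expTermℚ-nonneg 0≤R (m ℕ.+ j)) (sumℚ-nonneg (m ℕ.+ m ∸ (m ℕ.+ j)) (expTermℚ-nonneg 0≤R)))))

expℚ-0 : ∀ m → expℚ (suc m) 0ℚ ≡ 1ℚ
expℚ-0 zero    = refl
expℚ-0 (suc m) = trans (cong₂ ℚ._+_ (expℚ-0 m)
  (solve 2 (λ a b → con 0ℚ :* a :* b := con 0ℚ) refl (0ℚ ^ℚ m) (1/!ℚ (suc m)))) (ℚₚ.+-identityʳ 1ℚ)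

expℚ-*-neg≤ : ∀ R η → 0ℚ ℚ.< η → ∃ λ N → ∀ m → N ℕ.≤ m → ∀ u → ℚ.∣ u ∣ ℚ.≤ R →
              expℚ m u ℚ.* expℚ m (ℚ.- u) ℚ.≤ 1ℚ ℚ.+ η
-- The successor excludes m = 0, where the partial sum at 0 is empty and not 1.
expℚ-*-neg≤ R η 0<η = suc N , λ
  { (suc k) N<m u hu → let m = suc k in
    0≤q-p⇒p≤q (≤ʳ (trans (cong (λ t → η ℚ.- (expℚ m u ℚ.* expℚ m (ℚ.- u) ℚ.- t)) (trans (cong (expℚ m) (ℚₚ.+-inverseʳ u)) (expℚ-0 k)))
        (solve 2 (λ e p → e :- (p :- con 1ℚ) := (con 1ℚ :+ e) :- p) refl η (expℚ m u ℚ.* expℚ m (ℚ.- u))))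
      (p-q≤⇒ (ℚₚ.≤-trans (≤∣∣ _) (ℚₚ.≤-trans (expℚ-*-error hu (≤ˡ (sym (ℚₚ.∣-p∣≡∣p∣ u)) hu) m)
        (ℚₚ.≤-trans (≤∣∣ _) (small m (ℕₚ.<⇒≤ N<m))))))) }
  where
  E : ℝ
  E = exp (fromℚ (R ℚ.+ R))
  N : ℕ
  N = proj₁ (cauchy E η 0<η)
  small : ∀ m → N ℕ.≤ m → ℚ.∣ expℚ (m ℕ.+ m) (R ℚ.+ R) ℚ.- expℚ m (R ℚ.+ R) ∣ ℚ.≤ η
  small m p = ≤ˡ (cong₂ (λ a b → ℚ.∣ a ℚ.- b ∣) (seq-exp (fromℚ (R ℚ.+ R)) (m ℕ.+ m)) (seq-exp (fromℚ (R ℚ.+ R)) m))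
    (ℚₚ.<⇒≤ (proj₂ (cauchy E η 0<η) (m ℕ.+ m) m (ℕₚ.≤-trans p (ℕₚ.m≤m+n m m)) p))

1+u≤expℚ : ∀ {u} → 0ℚ ℚ.≤ u → ∀ {m} → 2 ℕ.≤ m → 1ℚ ℚ.+ u ℚ.≤ expℚ m u
1+u≤expℚ {u} 0≤u 2≤m = ℚₚ.≤-trans (ℚₚ.≤-reflexive
  (solve 1 (λ u → con 1ℚ :+ u := (con 0ℚ :+ con 1ℚ :* con 1ℚ) :+ u :* con 1ℚ :* con 1ℚ) refl u)) (expℚ-mono 0≤u 2≤m)

1/ℕ≤1′ : ∀ n .{{_ : ℕ.NonZero n}} → 1/ℕ n ℚ.≤ 1ℚ
1/ℕ≤1′ (suc n) = 1/ℕ≤1 n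

-- Each term is at most h^k, so the geometric sum bounds the left side by 1 - h^m. The product form
-- avoids a division by 1 - h, which may be 0.
[1-h]expℚ≤1 : ∀ {h} → 0ℚ ℚ.≤ h → h ℚ.≤ 1ℚ → ∀ m → (1ℚ ℚ.- h) ℚ.* expℚ m h ℚ.≤ 1ℚ
[1-h]expℚ≤1 {h} 0≤h h≤1 m = ℚₚ.≤-trans (*-monoʳ (p-q≤⇒ h≤1) (≤∣∣ (expℚ m h)))
  (ℚₚ.≤-trans (geometric (expTermℚ h) 1ℚ h h≤1 term≤ m)
    (0≤q-p⇒p≤q (≤ʳ (solve 1 (λ t → t := con 1ℚ :- con 1ℚ :* (con 1ℚ :- t)) refl (h ^ℚ m)) (^-nonneg 0≤h m))))
  where
  term≤ : ∀ j → ℚ.∣ expTermℚ h j ∣ ℚ.≤ 1ℚ ℚ.* h ^ℚ j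
  term≤ j = subst₂≤ (sym (ℚₚ.0≤p⇒∣p∣≡p (expTermℚ-nonneg 0≤h j))) (ℚₚ.*-comm (h ^ℚ j) 1ℚ)
    (*-monoʳ (^-nonneg 0≤h j) (1/ℕ≤1′ (j !) {{j ℕₚ.!≢0}}))

-- For a ≥ 0 this comes from 1 + a ≤ e^a, and for -1 ≤ a ≤ 0 from the comparison of e^{-a} with a
-- geometric series.
[1+a]expℚ-neg≤ : ∀ R η → 0ℚ ℚ.< η → ∃ λ N → ∀ m → N ℕ.≤ m → ∀ a → ℚ.∣ a ∣ ℚ.≤ R → 0ℚ ℚ.≤ 1ℚ ℚ.+ a →
                 (1ℚ ℚ.+ a) ℚ.* expℚ m (ℚ.- a) ℚ.≤ 1ℚ ℚ.+ η
[1+a]expℚ-neg≤ R η 0<η = 2 ℕ.⊔ N , λ m p a ∣a∣≤R 0≤1+a →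
    bound m (ℕₚ.m⊔n≤o⇒m≤o 2 N p) (ℕₚ.m⊔n≤o⇒n≤o 2 N p) a ∣a∣≤R 0≤1+a (ℚₚ.≤-total 0ℚ a) (ℚₚ.≤-total 0ℚ (expℚ m (ℚ.- a)))
  where
  N : ℕ
  N = proj₁ (expℚ-*-neg≤ R η 0<η)
  1≤1+η : 1ℚ ℚ.≤ 1ℚ ℚ.+ η
  1≤1+η = ≤ˡ (ℚₚ.+-identityʳ 1ℚ) (ℚₚ.+-monoʳ-≤ 1ℚ (ℚₚ.<⇒≤ 0<η))
  bound : ∀ m → 2 ℕ.≤ m → N ℕ.≤ m → ∀ a → ℚ.∣ a ∣ ℚ.≤ R → 0ℚ ℚ.≤ 1ℚ ℚ.+ a →
          0ℚ ℚ.≤ a ⊎ a ℚ.≤ 0ℚ → 0ℚ ℚ.≤ expℚ m (ℚ.- a) ⊎ expℚ m (ℚ.- a) ℚ.≤ 0ℚ →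
          (1ℚ ℚ.+ a) ℚ.* expℚ m (ℚ.- a) ℚ.≤ 1ℚ ℚ.+ η
  bound m 2≤m N≤m a ∣a∣≤R 0≤1+a (inj₁ 0≤a) (inj₁ 0≤E) = ℚₚ.≤-trans
    (*-mono 0≤1+a (1+u≤expℚ 0≤a 2≤m) 0≤E ℚₚ.≤-refl)
    (proj₂ (expℚ-*-neg≤ R η 0<η) m N≤m a ∣a∣≤R)
  -- A partial sum at the nonpositive argument -a may itself be negative; then 1 + a cannot be
  -- replaced by `expℚ m a`, but the product is at most 0.
  bound m 2≤m N≤m a ∣a∣≤R 0≤1+a (inj₁ 0≤a) (inj₂ E≤0) = ℚₚ.≤-trans
    (≤ʳ (ℚₚ.*-zeroʳ (1ℚ ℚ.+ a)) (*-monoʳ 0≤1+a E≤0)) (ℚₚ.≤-trans 0≤1 1≤1+η)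
  bound m 2≤m N≤m a ∣a∣≤R 0≤1+a (inj₂ a≤0) _ = ℚₚ.≤-trans
    (≤ˡ (cong (ℚ._* expℚ m (ℚ.- a)) (solve 1 (λ a → con 1ℚ :- (:- a) := con 1ℚ :+ a) refl a))
      ([1-h]expℚ≤1 (ℚₚ.neg-antimono-≤ a≤0)
        (0≤q-p⇒p≤q (≤ʳ (solve 1 (λ a → con 1ℚ :+ a := con 1ℚ :- (:- a)) refl a) 0≤1+a)) m))
    1≤1+η

-- Positivity of [1-x]_q + [x]_q

∣∣≤ : ∀ {p r} → p ℚ.≤ r → ℚ.- p ℚ.≤ r → ℚ.∣ p ∣ ℚ.≤ r
∣∣≤ {p} h k with ℚₚ.≤-total 0ℚ p
... | inj₁ 0≤p = ≤ˡ (sym (ℚₚ.0≤p⇒∣p∣≡p 0≤p)) h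
... | inj₂ p≤0 = ≤ˡ (trans (sym (ℚₚ.0≤p⇒∣p∣≡p (ℚₚ.neg-antimono-≤ p≤0))) (ℚₚ.∣-p∣≡∣p∣ p)) k

-- With A = 1 + x S and B = 1 + (1 - x) S, in the limit δ = η = 0 this says that
-- 2 - 1/A - 1/B = (S + 2 x (1 - x) S²) / (A B) ≥ S / (A B).
2-α-β-bound : ∀ {x S R h δ η α β} → let A = 1ℚ ℚ.+ x ℚ.* S ; B = 1ℚ ℚ.+ (1ℚ ℚ.- x) ℚ.* S in
  0ℚ ℚ.≤ x ℚ.+ δ → 0ℚ ℚ.≤ 1ℚ ℚ.+ δ ℚ.- x → 0ℚ ℚ.≤ S → S ℚ.≤ R → h ℚ.+ h ℚ.+ h ℚ.≤ S →
  0ℚ ℚ.≤ δ → δ ℚ.≤ 1ℚ → δ ℚ.* ((1ℚ ℚ.+ 1ℚ) ℚ.* (1ℚ ℚ.+ 1ℚ) ℚ.* (R ℚ.* R)) ℚ.≤ h →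
  0ℚ ℚ.≤ η → η ℚ.* (1ℚ ℚ.+ 1ℚ ℚ.+ R) ℚ.≤ h →
  0ℚ ℚ.≤ A → 0ℚ ℚ.≤ B → A ℚ.* α ℚ.≤ 1ℚ ℚ.+ η → B ℚ.* β ℚ.≤ 1ℚ ℚ.+ η →
  h ℚ.≤ (1ℚ ℚ.+ 1ℚ ℚ.- α ℚ.- β) ℚ.* (A ℚ.* B)
2-α-β-bound {x} {S} {R} {h} {δ} {η} {α} {β} 0≤x+δ 0≤1+δ-x 0≤S S≤R 3h≤S 0≤δ δ≤1 δR²≤h 0≤η ηR≤h 0≤A 0≤B Aα≤ Bβ≤ =
  0≤q-p⇒p≤q (≤ʳ
    -- The difference of the two sides is a sum of six nonnegative terms. Of the 3h that S provides,
    -- one h absorbs the error from δ, one the error from η, and one is the lower bound itself.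
    (solve 7 (λ x S h δ η α β →
        let 2′ = con 1ℚ :+ con 1ℚ
            A′ = con 1ℚ :+ x :* S
            B′ = con 1ℚ :+ (con 1ℚ :- x) :* S
        in B′ :* ((con 1ℚ :+ η) :- A′ :* α) :+ A′ :* ((con 1ℚ :+ η) :- B′ :* β) :+ (S :- (h :+ h :+ h))
           :+ 2′ :* ((x :+ δ) :* (con 1ℚ :+ δ :- x)) :* (S :* S)
           :+ (h :- δ :* (2′ :* (con 1ℚ :+ δ) :* (S :* S))) :+ (h :- η :* (2′ :+ S))
           := (2′ :- α :- β) :* (A′ :* B′) :- h)
      refl x S h δ η α β)
    (+-nonneg (+-nonneg (+-nonneg (+-nonneg (+-nonneg
      (*-nonneg 0≤B (p-q≤⇒ Aα≤))
      (*-nonneg 0≤A (p-q≤⇒ Bβ≤)))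
      (p-q≤⇒ 3h≤S))
      (*-nonneg (*-nonneg 0≤2 (*-nonneg 0≤x+δ 0≤1+δ-x)) 0≤SS))
      (p-q≤⇒ (ℚₚ.≤-trans (*-monoʳ 0≤δ (*-mono (*-nonneg 0≤2 (+-nonneg 0≤1 0≤δ)) (*-monoʳ 0≤2 (ℚₚ.+-monoʳ-≤ 1ℚ δ≤1)) 0≤SS (*-mono 0≤S S≤R 0≤S S≤R))) δR²≤h)))
      (p-q≤⇒ (ℚₚ.≤-trans (*-monoʳ 0≤η (ℚₚ.+-monoʳ-≤ (1ℚ ℚ.+ 1ℚ) S≤R)) ηR≤h))))
  where
  0≤2 : 0ℚ ℚ.≤ 1ℚ ℚ.+ 1ℚ
  0≤2 = ℚₚ.<⇒≤ 0<2
  0≤SS : 0ℚ ℚ.≤ S ℚ.* S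
  0≤SS = *-nonneg 0≤S 0≤S

-- The positive h excludes t ≤ 0, so enlarging the factor c preserves the inequality.
*-mono-≤-pos : ∀ {h t c Q} → 0ℚ ℚ.< h → 0ℚ ℚ.≤ c → c ℚ.≤ Q → h ℚ.≤ t ℚ.* c → h ℚ.≤ t ℚ.* Q
*-mono-≤-pos {h} {t} {c} 0<h 0≤c c≤Q h≤tc with ℚₚ.≤-total 0ℚ t
... | inj₁ 0≤t = ℚₚ.≤-trans h≤tc (*-monoʳ 0≤t c≤Q)
... | inj₂ t≤0 = contradiction
  (ℚₚ.<-≤-trans 0<h (ℚₚ.≤-trans h≤tc (≤ʳ (ℚₚ.*-zeroˡ c) (ℚₚ.*-monoʳ-≤-nonNeg c {{ℚ.nonNegative 0≤c}} t≤0))))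
  (ℚₚ.<-irrefl refl)

-- Here y lies only in [-δ, 1 + δ]. From δ ≤ 1 both y and 1 - y have absolute value at most 2, and
-- from δ R ≤ 1 both 1 + y S and 1 + (1 - y) S are nonnegative, as the exponential estimate
-- requires. Finally A and B are replaced by the bound 1 + 2R, which is independent of m and y.
2-expℚ-bound : ∀ m y S R h δ η → 0ℚ ℚ.< h → 0ℚ ℚ.≤ δ → δ ℚ.≤ 1ℚ → δ ℚ.* R ℚ.≤ 1ℚ →
  δ ℚ.* ((1ℚ ℚ.+ 1ℚ) ℚ.* (1ℚ ℚ.+ 1ℚ) ℚ.* (R ℚ.* R)) ℚ.≤ h →
  0ℚ ℚ.≤ η → η ℚ.* (1ℚ ℚ.+ 1ℚ ℚ.+ R) ℚ.≤ h →
  0ℚ ℚ.≤ S → ℚ.∣ S ∣ ℚ.≤ R → h ℚ.+ h ℚ.+ h ℚ.≤ S →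
  0ℚ ℚ.≤ y ℚ.+ δ → 0ℚ ℚ.≤ 1ℚ ℚ.+ δ ℚ.- y →
  (∀ a → ℚ.∣ a ∣ ℚ.≤ (1ℚ ℚ.+ 1ℚ) ℚ.* R → 0ℚ ℚ.≤ 1ℚ ℚ.+ a → (1ℚ ℚ.+ a) ℚ.* expℚ m (ℚ.- a) ℚ.≤ 1ℚ ℚ.+ η) →
  h ℚ.≤ (1ℚ ℚ.+ 1ℚ ℚ.- expℚ m (ℚ.- (y ℚ.* S)) ℚ.- expℚ m (ℚ.- ((1ℚ ℚ.- y) ℚ.* S)))
        ℚ.* ((1ℚ ℚ.+ (1ℚ ℚ.+ 1ℚ) ℚ.* R) ℚ.* (1ℚ ℚ.+ (1ℚ ℚ.+ 1ℚ) ℚ.* R))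
2-expℚ-bound m y S R h δ η 0<h 0≤δ δ≤1 δR≤1 δR²≤h 0≤η ηR≤h 0≤S ∣S∣≤R 3h≤S 0≤y+δ 0≤1+δ-y exp≤ =
  *-mono-≤-pos {h} {1ℚ ℚ.+ 1ℚ ℚ.- α ℚ.- β} {A ℚ.* B} 0<h (*-nonneg 0≤A 0≤B)
    (*-mono 0≤A (ℚₚ.+-monoʳ-≤ 1ℚ (ℚₚ.≤-trans (≤∣∣ (y ℚ.* S)) ∣a∣≤))
            0≤B (ℚₚ.+-monoʳ-≤ 1ℚ (ℚₚ.≤-trans (≤∣∣ ((1ℚ ℚ.- y) ℚ.* S)) ∣b∣≤)))
    (2-α-β-bound {y} {S} {R} {h} {δ} {η} {α} {β} 0≤y+δ 0≤1+δ-y 0≤S S≤R 3h≤S 0≤δ δ≤1 δR²≤h 0≤η ηR≤h 0≤A 0≤B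
      (exp≤ (y ℚ.* S) ∣a∣≤ 0≤A) (exp≤ ((1ℚ ℚ.- y) ℚ.* S) ∣b∣≤ 0≤B))
  where
  A B α β : ℚ
  A = 1ℚ ℚ.+ y ℚ.* S
  B = 1ℚ ℚ.+ (1ℚ ℚ.- y) ℚ.* S
  α = expℚ m (ℚ.- (y ℚ.* S))
  β = expℚ m (ℚ.- ((1ℚ ℚ.- y) ℚ.* S))
  S≤R : S ℚ.≤ R
  S≤R = ℚₚ.≤-trans (≤∣∣ S) ∣S∣≤R
  0≤1+zS : ∀ z → 0ℚ ℚ.≤ z ℚ.+ δ → 0ℚ ℚ.≤ 1ℚ ℚ.+ z ℚ.* S
  0≤1+zS z 0≤z+δ = ≤ʳ
    (solve 3 (λ z S d → (con 1ℚ :- d :* S) :+ (z :+ d) :* S := con 1ℚ :+ z :* S) refl z S δ)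
    (+-nonneg (p-q≤⇒ (ℚₚ.≤-trans (*-monoʳ 0≤δ S≤R) δR≤1)) (*-nonneg 0≤z+δ 0≤S))
  ∣zS∣≤2R : ∀ z → 0ℚ ℚ.≤ z ℚ.+ δ → 0ℚ ℚ.≤ 1ℚ ℚ.+ δ ℚ.- z → ℚ.∣ z ℚ.* S ∣ ℚ.≤ (1ℚ ℚ.+ 1ℚ) ℚ.* R
  ∣zS∣≤2R z 0≤z+δ 0≤1+δ-z = ∣*∣≤ z S {1ℚ ℚ.+ 1ℚ} (∣∣≤
    (0≤q-p⇒p≤q (≤ʳ (solve 2 (λ z d → (con 1ℚ :- d) :+ (con 1ℚ :+ d :- z) := con 1ℚ :+ con 1ℚ :- z) refl z δ)
      (+-nonneg (p-q≤⇒ δ≤1) 0≤1+δ-z)))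
    (0≤q-p⇒p≤q (≤ʳ (solve 2 (λ z d → con 1ℚ :+ (con 1ℚ :- d) :+ (z :+ d) := con 1ℚ :+ con 1ℚ :- (:- z)) refl z δ)
      (+-nonneg (+-nonneg 0≤1 (p-q≤⇒ δ≤1)) 0≤z+δ)))) ∣S∣≤R
  0≤1-y+δ : 0ℚ ℚ.≤ (1ℚ ℚ.- y) ℚ.+ δ
  0≤1-y+δ = ≤ʳ (solve 2 (λ y d → con 1ℚ :+ d :- y := (con 1ℚ :- y) :+ d) refl y δ) 0≤1+δ-y
  0≤A : 0ℚ ℚ.≤ A
  0≤A = 0≤1+zS y 0≤y+δ
  0≤B : 0ℚ ℚ.≤ B
  0≤B = 0≤1+zS (1ℚ ℚ.- y) 0≤1-y+δ
  ∣a∣≤ : ℚ.∣ y ℚ.* S ∣ ℚ.≤ (1ℚ ℚ.+ 1ℚ) ℚ.* R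
  ∣a∣≤ = ∣zS∣≤2R y 0≤y+δ 0≤1+δ-y
  ∣b∣≤ : ℚ.∣ (1ℚ ℚ.- y) ℚ.* S ∣ ℚ.≤ (1ℚ ℚ.+ 1ℚ) ℚ.* R
  ∣b∣≤ = ∣zS∣≤2R (1ℚ ℚ.- y) 0≤1-y+δ
    (≤ʳ (solve 2 (λ y d → y :+ d := con 1ℚ :+ d :- (con 1ℚ :- y)) refl y δ) 0≤y+δ)

-- Choice of the error tolerances

⊓-pos : ∀ {a b} → 0ℚ ℚ.< a → 0ℚ ℚ.< b → 0ℚ ℚ.< a ℚ.⊓ b
⊓-pos {a} {b} 0<a 0<b with ℚₚ.⊓-sel a b
... | inj₁ e = <ʳ (sym e) 0<a
... | inj₂ e = <ʳ (sym e) 0<b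

tolerance : ∀ {R h} → 0ℚ ℚ.< R → 0ℚ ℚ.< h → ∃ λ δ → 0ℚ ℚ.< δ × δ ℚ.≤ 1ℚ × δ ℚ.* R ℚ.≤ 1ℚ ×
  δ ℚ.* ((1ℚ ℚ.+ 1ℚ) ℚ.* (1ℚ ℚ.+ 1ℚ) ℚ.* (R ℚ.* R)) ℚ.≤ h
tolerance {R} {h} 0<R 0<h =
  -- δ is the minimum of 1 / (R + 1), which gives both δ ≤ 1 and δ R ≤ 1, and h / C, which gives the
  -- last bound.
  let D₁ , 0<D₁ , eq₁ = recip (+-pos (ℚₚ.<⇒≤ 0<R) 0<1)
      D₂ , 0<D₂ , eq₂ = scale 0<C 0<h
      δ   = D₁ ℚ.⊓ D₂
      0<δ = ⊓-pos 0<D₁ 0<D₂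
      0≤R = ℚₚ.<⇒≤ 0<R
      δ[R+1]≤1 : δ ℚ.* (R ℚ.+ 1ℚ) ℚ.≤ 1ℚ
      δ[R+1]≤1 = ≤ʳ eq₁ (*-mono (ℚₚ.<⇒≤ 0<δ) (ℚₚ.p⊓q≤p D₁ D₂) (+-nonneg 0≤R 0≤1) ℚₚ.≤-refl)
  in δ , 0<δ ,
     ℚₚ.≤-trans (≤ˡ (ℚₚ.*-identityʳ δ) (*-monoʳ (ℚₚ.<⇒≤ 0<δ) (≤ˡ (ℚₚ.+-identityˡ 1ℚ) (ℚₚ.+-monoˡ-≤ 1ℚ 0≤R)))) δ[R+1]≤1 ,
     ℚₚ.≤-trans (*-monoʳ (ℚₚ.<⇒≤ 0<δ) (≤ˡ (ℚₚ.+-identityʳ R) (ℚₚ.+-monoʳ-≤ R 0≤1))) δ[R+1]≤1 ,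
     ≤ʳ (trans (ℚₚ.*-comm D₂ C) eq₂) (*-mono (ℚₚ.<⇒≤ 0<δ) (ℚₚ.p⊓q≤q D₁ D₂) (ℚₚ.<⇒≤ 0<C) ℚₚ.≤-refl)
  where
  C : ℚ
  C = (1ℚ ℚ.+ 1ℚ) ℚ.* (1ℚ ℚ.+ 1ℚ) ℚ.* (R ℚ.* R)
  0<C : 0ℚ ℚ.< C
  0<C = *-pos (*-pos 0<2 0<2) (*-pos 0<R 0<R)

*-recip-≤ : ∀ {h t Q Q⁻¹} → 0ℚ ℚ.< Q⁻¹ → Q⁻¹ ℚ.* Q ≡ 1ℚ → h ℚ.≤ t ℚ.* Q → h ℚ.* Q⁻¹ ℚ.≤ t
*-recip-≤ {h} {t} {Q} {Q⁻¹} 0<Q⁻¹ Q⁻¹Q≡1 h≤tQ = ≤ʳ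
  (trans (ℚₚ.*-assoc t Q Q⁻¹) (trans (cong (t ℚ.*_) (trans (ℚₚ.*-comm Q Q⁻¹) Q⁻¹Q≡1)) (ℚₚ.*-identityʳ t)))
  (ℚₚ.*-monoʳ-≤-nonNeg Q⁻¹ {{ℚ.nonNegative (ℚₚ.<⇒≤ 0<Q⁻¹)}} h≤tQ)

-- `S` stands for -log q. The gap is h / (1 + 2R)² with h = s / 3 and R an eventual bound on the
-- absolute value of `S`. The tolerances δ and η depend only on R and h, so the indices for x and
-- for the exponential can be chosen after them.
2-exp-positive : ∀ S → (∃ λ s → 0ℚ ℚ.< s × ∃ λ N → ∀ m → N ℕ.≤ m → s ℚ.≤ seq S m) →
  ∀ x → 0ℝ ≤ x → x ≤ 1ℝ → ∃ λ g → 0ℚ ℚ.< g × ∃ λ N → ∀ m → N ℕ.≤ m →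
  g ℚ.≤ 1ℚ ℚ.+ 1ℚ ℚ.- expℚ m (ℚ.- (seq x m ℚ.* seq S m)) ℚ.- expℚ m (ℚ.- ((1ℚ ℚ.- seq x m) ℚ.* seq S m))
2-exp-positive S (s , 0<s , N₁ , s≤S) x 0≤x x≤1 =
  h ℚ.* Q⁻¹ , *-pos 0<h 0<Q⁻¹ , N₁ ℕ.⊔ (N₂ ℕ.⊔ (N₃ ℕ.⊔ (N₄ ℕ.⊔ N₅))) , bound
  where
  SB : ∃ λ R → 0ℚ ℚ.< R × ∃ λ N → ∀ n → N ℕ.≤ n → ℚ.∣ seq S n ∣ ℚ.≤ R
  SB = bounded (cauchy S)
  R : ℚ
  R = proj₁ SB
  0<R : 0ℚ ℚ.< R
  0<R = proj₁ (proj₂ SB)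
  N₂ : ℕ
  N₂ = proj₁ (proj₂ (proj₂ SB))
  hB : ∃ λ h → 0ℚ ℚ.< h × (1ℚ ℚ.+ 1ℚ ℚ.+ 1ℚ) ℚ.* h ≡ s
  hB = scale (+-pos (ℚₚ.<⇒≤ 0<2) 0<1) 0<s
  h : ℚ
  h = proj₁ hB
  0<h : 0ℚ ℚ.< h
  0<h = proj₁ (proj₂ hB)
  δB : ∃ λ δ → 0ℚ ℚ.< δ × δ ℚ.≤ 1ℚ × δ ℚ.* R ℚ.≤ 1ℚ × δ ℚ.* ((1ℚ ℚ.+ 1ℚ) ℚ.* (1ℚ ℚ.+ 1ℚ) ℚ.* (R ℚ.* R)) ℚ.≤ h
  δB = tolerance 0<R 0<h
  δ : ℚ
  δ = proj₁ δB
  0<δ : 0ℚ ℚ.< δ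
  0<δ = proj₁ (proj₂ δB)
  ηB : ∃ λ η → 0ℚ ℚ.< η × (1ℚ ℚ.+ 1ℚ ℚ.+ R) ℚ.* η ≡ h
  ηB = scale (+-pos (ℚₚ.<⇒≤ 0<2) 0<R) 0<h
  η : ℚ
  η = proj₁ ηB
  0<η : 0ℚ ℚ.< η
  0<η = proj₁ (proj₂ ηB)
  expB : ∃ λ N → ∀ m → N ℕ.≤ m → ∀ a → ℚ.∣ a ∣ ℚ.≤ (1ℚ ℚ.+ 1ℚ) ℚ.* R → 0ℚ ℚ.≤ 1ℚ ℚ.+ a →
         (1ℚ ℚ.+ a) ℚ.* expℚ m (ℚ.- a) ℚ.≤ 1ℚ ℚ.+ η
  expB = [1+a]expℚ-neg≤ ((1ℚ ℚ.+ 1ℚ) ℚ.* R) η 0<η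
  N₃ N₄ N₅ : ℕ
  N₃ = proj₁ expB
  N₄ = proj₁ (0≤x δ 0<δ)
  N₅ = proj₁ (x≤1 δ 0<δ)
  Q : ℚ
  Q = (1ℚ ℚ.+ (1ℚ ℚ.+ 1ℚ) ℚ.* R) ℚ.* (1ℚ ℚ.+ (1ℚ ℚ.+ 1ℚ) ℚ.* R)
  0<1+2R : 0ℚ ℚ.< 1ℚ ℚ.+ (1ℚ ℚ.+ 1ℚ) ℚ.* R
  0<1+2R = +-pos 0≤1 (*-pos 0<2 0<R)
  QB : ∃ λ b → 0ℚ ℚ.< b × b ℚ.* Q ≡ 1ℚ
  QB = recip (*-pos 0<1+2R 0<1+2R)
  Q⁻¹ : ℚ
  Q⁻¹ = proj₁ QB
  0<Q⁻¹ : 0ℚ ℚ.< Q⁻¹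
  0<Q⁻¹ = proj₁ (proj₂ QB)
  bound : ∀ m → N₁ ℕ.⊔ (N₂ ℕ.⊔ (N₃ ℕ.⊔ (N₄ ℕ.⊔ N₅))) ℕ.≤ m → h ℚ.* Q⁻¹ ℚ.≤
    1ℚ ℚ.+ 1ℚ ℚ.- expℚ m (ℚ.- (seq x m ℚ.* seq S m)) ℚ.- expℚ m (ℚ.- ((1ℚ ℚ.- seq x m) ℚ.* seq S m))
  bound m p = *-recip-≤ {Q = Q} 0<Q⁻¹ (proj₂ (proj₂ QB))
    (2-expℚ-bound m (seq x m) (seq S m) R h δ η 0<h (ℚₚ.<⇒≤ 0<δ)
      (proj₁ (proj₂ (proj₂ δB))) (proj₁ (proj₂ (proj₂ (proj₂ δB)))) (proj₂ (proj₂ (proj₂ (proj₂ δB))))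
      (ℚₚ.<⇒≤ 0<η) (ℚₚ.≤-reflexive (trans (ℚₚ.*-comm η (1ℚ ℚ.+ 1ℚ ℚ.+ R)) (proj₂ (proj₂ ηB))))
      (ℚₚ.≤-trans (ℚₚ.<⇒≤ 0<s) s≤Sₘ) (proj₂ (proj₂ (proj₂ SB)) m (ℕₚ.m⊔n≤o⇒m≤o N₂ _ p₂))
      (≤ˡ (trans (sym (proj₂ (proj₂ hB))) (solve 1 (λ h → (con 1ℚ :+ con 1ℚ :+ con 1ℚ) :* h := h :+ h :+ h) refl h)) s≤Sₘ)
      (ℚₚ.<⇒≤ (proj₂ (0≤x δ 0<δ) m (ℕₚ.m⊔n≤o⇒m≤o N₄ N₅ p₄)))
      (p-q≤⇒ (ℚₚ.<⇒≤ (proj₂ (x≤1 δ 0<δ) m (ℕₚ.m⊔n≤o⇒n≤o N₄ N₅ p₄))))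
      (proj₂ expB m (ℕₚ.m⊔n≤o⇒m≤o N₃ (N₄ ℕ.⊔ N₅) p₃)))
    where
    p₂ : N₂ ℕ.⊔ (N₃ ℕ.⊔ (N₄ ℕ.⊔ N₅)) ℕ.≤ m
    p₂ = ℕₚ.m⊔n≤o⇒n≤o N₁ _ p
    p₃ : N₃ ℕ.⊔ (N₄ ℕ.⊔ N₅) ℕ.≤ m
    p₃ = ℕₚ.m⊔n≤o⇒n≤o N₂ _ p₂
    p₄ : N₄ ℕ.⊔ N₅ ℕ.≤ m
    p₄ = ℕₚ.m⊔n≤o⇒n≤o N₃ _ p₃
    s≤Sₘ : s ℚ.≤ seq S m
    s≤Sₘ = s≤S m (ℕₚ.m⊔n≤o⇒m≤o N₁ _ p)

-- Lower bounds for -log q and for the sum of the two q-numbers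

module _ (q : ℝ) (0<q : 0ℝ < q) (q<1 : q < 1ℝ) where

  -log : ℝ
  -log = series (logTerm q) (logTail q 0<q q<1)

  -- The first term of Mercator's series is 1 - q, which is at least ε, and the other terms are
  -- nonnegative. The index is a successor so that the first term is present in the partial sum.
  -log-positive : ∃ λ s → 0ℚ ℚ.< s × ∃ λ N → ∀ m → N ℕ.≤ m → s ℚ.≤ seq -log m
  -log-positive = let ε , 0<ε , N , h = q<1 in ε , 0<ε , suc N , λ
    { (suc m) N<m →
      let u = seq (1ℝ - q) (suc m)
          ε≤u : ε ℚ.≤ u
          ε≤u = ≤ˡ (solve 2 (λ a e → (a :+ e) :- a := e) refl (seq q (suc m)) ε)
                  (ℚₚ.+-monoˡ-≤ (ℚ.- seq q (suc m)) (ℚₚ.<⇒≤ (h (suc m) (ℕₚ.<⇒≤ N<m))))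
          0≤u = ℚₚ.≤-trans (ℚₚ.<⇒≤ 0<ε) ε≤u
          0≤term : ∀ k → 0ℚ ℚ.≤ seq (logTerm q k) (suc m)
          0≤term k = *-nonneg (≤ʳ (sym (seq-^ (1ℝ - q) (suc k) (suc m))) (^-nonneg 0≤u (suc k))) (ℚₚ.<⇒≤ (0<1/ℕ (suc k)))
      in ≤ʳ (sym (sumℚ-suc m (λ k → seq (logTerm q k) (suc m))))
           (≤ˡ (ℚₚ.+-identityʳ ε) (ℚₚ.+-mono-≤
             (≤ʳ (solve 1 (λ u → u := (u :* con 1ℚ) :* con 1ℚ) refl u) ε≤u)
             (sumℚ-nonneg m λ k → 0≤term (suc k)))) }

  -- Since 0 < 1 - q ≤ 1, dividing by 1 - q does not decrease a nonnegative number; the gap found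
  -- for 2 - q^x - q^{1-x} therefore also serves for the q-numbers.
  1≤inv[1-q] : ∃ λ N → ∀ m → N ℕ.≤ m → 1ℚ ℚ.≤ invℚ (seq (1ℝ - q) m)
  1≤inv[1-q] = let ε , 0<ε , N , h = q<1 ; ε′ , 0<ε′ , N′ , h′ = 0<q in N ℕ.⊔ N′ , λ m p →
    let a = seq q m
        u = seq (1ℝ - q) m
        0<u : 0ℚ ℚ.< u
        0<u = p-q<⇒ (ℚₚ.≤-<-trans (≤ˡ (ℚₚ.+-identityʳ a) (ℚₚ.+-monoʳ-≤ a (ℚₚ.<⇒≤ 0<ε))) (h m (ℕₚ.m⊔n≤o⇒m≤o N N′ p)))
        0≤a : 0ℚ ℚ.≤ a
        0≤a = ℚₚ.≤-trans (ℚₚ.<⇒≤ 0<ε′) (≤ˡ (ℚₚ.+-identityˡ ε′) (ℚₚ.<⇒≤ (h′ m (ℕₚ.m⊔n≤o⇒n≤o N N′ p))))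
    in ℚₚ.*-cancelʳ-≤-pos u {{ℚ.positive 0<u}} (subst₂≤ (sym (ℚₚ.*-identityˡ u))
         (sym (invℚ-inverse u λ e → ℚₚ.<⇒≢ 0<u (sym e)))
         (0≤q-p⇒p≤q (≤ʳ (solve 1 (λ a → a := con 1ℚ :- (con 1ℚ :- a)) refl a) 0≤a)))

  module _ (x : ℝ) (0≤x : 0ℝ ≤ x) (x≤1 : x ≤ 1ℝ) where

    private
      α β : ℕ → ℚ
      α m = seq (rpow q 0<q q<1 x) m
      β m = seq (rpow q 0<q q<1 (1ℝ - x)) m

    2-qˣ-q¹⁻ˣ-positive : ∃ λ g → 0ℚ ℚ.< g × ∃ λ N → ∀ m → N ℕ.≤ m → g ℚ.≤ 1ℚ ℚ.+ 1ℚ ℚ.- α m ℚ.- β m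
    2-qˣ-q¹⁻ˣ-positive = let g , 0<g , N , h = 2-exp-positive -log -log-positive x 0≤x x≤1 in
      g , 0<g , N , λ m p → ≤ʳ (cong₂ (λ a b → 1ℚ ℚ.+ 1ℚ ℚ.- a ℚ.- b) (sym (α≡ m)) (sym (β≡ m))) (h m p)
      where
      α≡ : ∀ m → α m ≡ expℚ m (ℚ.- (seq x m ℚ.* seq -log m))
      α≡ m = trans (seq-exp (x * log q 0<q q<1) m) (cong (expℚ m) (sym (ℚₚ.neg-distribʳ-* (seq x m) (seq -log m))))
      β≡ : ∀ m → β m ≡ expℚ m (ℚ.- ((1ℚ ℚ.- seq x m) ℚ.* seq -log m))
      β≡ m = trans (seq-exp ((1ℝ - x) * log q 0<q q<1) m) (cong (expℚ m) (sym (ℚₚ.neg-distribʳ-* (1ℚ ℚ.- seq x m) (seq -log m))))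

    qNumber-sum-positive : ∃ λ g → 0ℚ ℚ.< g × ∃ λ N → ∀ m → N ℕ.≤ m →
                           g ℚ.≤ seq (qNumber q 0<q q<1 (1ℝ - x) + qNumber q 0<q q<1 x) m
    qNumber-sum-positive =
      let g , 0<g , N , h = 2-qˣ-q¹⁻ˣ-positive
          N′ , h′ = 1≤inv[1-q]
      in g , 0<g , N ℕ.⊔ N′ , λ m p →
      let g≤ = h m (ℕₚ.m⊔n≤o⇒m≤o N N′ p)
          v = invℚ (seq (1ℝ - q) m)
      in ≤ʳ (solve 3 (λ a b v → (con 1ℚ :+ con 1ℚ :- a :- b) :* v := (con 1ℚ :- b) :* v :+ (con 1ℚ :- a) :* v) refl (α m) (β m) v)
           (ℚₚ.≤-trans g≤ (≤ˡ (ℚₚ.*-identityʳ _)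
             (*-monoʳ (ℚₚ.≤-trans (ℚₚ.<⇒≤ 0<g) g≤) (h′ m (ℕₚ.m⊔n≤o⇒n≤o N N′ p)))))

-- The powers of the lower bound g bound those of x from below; half of g^k is the witness because
-- `_<_` demands a strict inequality.
^-#0 : ∀ x k → (∃ λ g → 0ℚ ℚ.< g × ∃ λ N → ∀ m → N ℕ.≤ m → g ℚ.≤ seq x m) → (x ^ k) # 0ℝ
^-#0 x k (g , 0<g , N , h) = inj₂ (½ ℚ.* g ^ℚ k , ½*-pos (^-pos k) , N , λ m p →
  <ˡ (sym (ℚₚ.+-identityˡ _)) (ℚₚ.<-≤-trans (½*-< (^-pos k)) (≤ʳ (sym (seq-^ x k m)) (^-mono m p k))))
  where
  ^-pos : ∀ j → 0ℚ ℚ.< g ^ℚ j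
  ^-pos zero    = 0<1
  ^-pos (suc j) = *-pos 0<g (^-pos j)
  ^-mono : ∀ m → N ℕ.≤ m → ∀ j → g ^ℚ j ℚ.≤ seq x m ^ℚ j
  ^-mono m p zero    = ℚₚ.≤-refl
  ^-mono m p (suc j) = *-mono (ℚₚ.<⇒≤ 0<g) (h m p) (ℚₚ.<⇒≤ (^-pos j)) (^-mono m p j)

-- The Bernstein polynomials

-- An exact identity of rationals at one fixed index m, so that the computation takes place entirely
-- in ℚ.
seq-bernstein-sum : ∀ (b : ℕ → ℝ) X Y n i → 1 ℕ.≤ i → (i≤n : i ℕ.≤ n) → ∀ m →
  (∀ k → k ℕ.≤ n → seq (b k) m ≡ ι (n !) ℚ.* (expTermℚ X k ℚ.* expTermℚ Y (n ∸ k))) →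
  seq (∑[ i ∸ 1 ⋯ n ] (λ k → binomialRatio k n i i≤n * b k)) m ≡ (X ℚ.+ Y) ^ℚ (n ∸ i) ℚ.* X ^ℚ i
-- The theorem's i is `suc i` here, so the sum starts at `i`, where the binomial coefficient is 0.
-- Abstracting n - i to `p` allows n to be replaced by `suc i ℕ.+ p`.
seq-bernstein-sum b X Y n (suc i) _ i<n m b≡ = shifted (n ∸ suc i) (ℕₚ.m+[n∸m]≡n i<n)
  where
  open ≡-Reasoning
  instance
    nonZero : ℕ.NonZero (n C suc i)
    nonZero = nCk-nonZero i<n
  f : ℕ → ℝ
  f k = binomialRatio k n (suc i) i<n * b k
  F : ℕ → ℚ
  F j = seq (f (i ℕ.+ j)) m
  ratio : ℕ → ℚ
  ratio k = + (k C suc i) ℚ./ (n C suc i)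
  first : F 0 ≡ 0ℚ
  first = trans (cong (ℚ._* seq (b (i ℕ.+ 0)) m)
      (trans (/≡ι*1/ℕ ((i ℕ.+ 0) C suc i) (n C suc i))
        (trans (cong (λ c → ι c ℚ.* 1/ℕ (n C suc i)) (k>n⇒nCk≡0 (ℕ.s≤s (ℕₚ.≤-reflexive (ℕₚ.+-identityʳ i)))))
          (ℚₚ.*-zeroˡ (1/ℕ (n C suc i))))))
    (ℚₚ.*-zeroˡ (seq (b (i ℕ.+ 0)) m))
  shifted : ∀ p → suc i ℕ.+ p ≡ n → seq (∑[ i ⋯ n ] f) m ≡ (X ℚ.+ Y) ^ℚ p ℚ.* X ^ℚ suc i
  shifted p refl = begin
    seq (sum (suc n ∸ i) (λ j → f (i ℕ.+ j))) m
      ≡⟨ seq-sum (suc n ∸ i) (λ j → f (i ℕ.+ j)) m ⟩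
    sumℚ (suc n ∸ i) F
      ≡⟨ cong (λ l → sumℚ l F) length≡ ⟩
    sumℚ (suc (suc p)) F
      ≡⟨ sumℚ-suc (suc p) F ⟩
    F 0 ℚ.+ sumℚ (suc p) (λ l → F (suc l))
      ≡⟨ cong₂ ℚ._+_ first (sumℚ-cong (suc p) λ l l≤p → rest l (ℕ.s≤s⁻¹ l≤p)) ⟩
    0ℚ ℚ.+ sumℚ (suc p) G
      ≡⟨ ℚₚ.+-identityˡ (sumℚ (suc p) G) ⟩
    sumℚ (suc p) G
      ≡⟨ bernstein-sum X Y (suc i) p ⟩
    (X ℚ.+ Y) ^ℚ p ℚ.* X ^ℚ suc i ∎
    where
    G : ℕ → ℚ
    G l = ratio (suc i ℕ.+ l) ℚ.* (ι (n !) ℚ.* (expTermℚ X (suc i ℕ.+ l) ℚ.* expTermℚ Y (p ∸ l)))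
    -- There are p + 1 terms for `bernstein-sum` and one more for the vanishing first term.
    length≡ : suc n ∸ i ≡ suc (suc p)
    length≡ = trans (cong (_∸ i) (sym (trans (ℕₚ.+-suc i (suc p)) (cong suc (ℕₚ.+-suc i p))))) (ℕₚ.m+n∸m≡n i (suc (suc p)))
    rest : ∀ l → l ℕ.≤ p → F (suc l) ≡ G l
    rest l l≤p = trans (cong (λ k → seq (f k) m) (ℕₚ.+-suc i l))
      (cong (ratio (suc i ℕ.+ l) ℚ.*_)
        (trans (b≡ (suc i ℕ.+ l) (ℕₚ.+-monoʳ-≤ (suc i) l≤p))
          (cong (λ d → ι (n !) ℚ.* (expTermℚ X (suc i ℕ.+ l) ℚ.* expTermℚ Y d)) (ℕₚ.[m+n]∸[m+o]≡n∸o (suc i) p l))))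

seq-t^-diag : ∀ k m → seq ((t^ k) k) m ≡ 1ℚ
seq-t^-diag k m with k ℕ.≡ᵇ k in eq
... | true  = refl
... | false = contradiction (subst T eq (ℕₚ.≡⇒≡ᵇ k k refl)) λ ()

seq-t^-off : ∀ k m j → j ≢ k → seq ((t^ k) j) m ≡ 0ℚ
seq-t^-off k m j j≢k with j ℕ.≡ᵇ k in eq
... | false = refl
... | true  = contradiction (ℕₚ.≡ᵇ⇒≡ j k (subst T (sym eq) _)) j≢k

module _ (q : ℝ) (0<q : 0ℝ < q) (q<1 : q < 1ℝ) (x : ℝ) where

  private
    X Y : ℕ → ℚ
    X m = seq (qNumber q 0<q q<1 x) m
    Y m = seq (qNumber q 0<q q<1 (1ℝ - x)) m

  -- Convolution with `t^ k` shifts the exponential series by k: only the term j = k survives.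
  seq-bernsteinGF : ∀ {k n} → k ℕ.≤ n → ∀ m →
    seq (bernsteinGF q 0<q q<1 x k n) m ≡ expTermℚ (X m) k ℚ.* expTermℚ (Y m) (n ∸ k)
  seq-bernsteinGF {k} {n} k≤n m = cong₂ ℚ._*_
    (cong (ℚ._* 1/!ℚ k) (seq-^ (qNumber q 0<q q<1 x) k m))
    (trans (seq-sum (suc n) (λ j → (t^ k) j * expSeries y (n ∸ j)) m)
      (trans (sumℚ-delta (λ j → seq ((t^ k) j) m) (λ j → seq (expSeries y (n ∸ j)) m)
               (ℕ.s≤s k≤n) (seq-t^-diag k m) (seq-t^-off k m))
        (cong (ℚ._* 1/!ℚ (n ∸ k)) (seq-^ y (n ∸ k) m))))
    where
    y : ℝ
    y = qNumber q 0<q q<1 (1ℝ - x)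

  explicitBernstein : ℕ → ℕ → ℝ
  explicitBernstein k n = fromℚ (ι (n !)) * bernsteinGF q 0<q q<1 x k n

  -- Multiplying the coefficient identity by n! determines `B k n` up to `≈`. It can then be
  -- exchanged for a real whose approximations are known exactly.
  modifiedBernstein≈explicitBernstein : ∀ B → IsModifiedBernstein q 0<q q<1 x B → ∀ k n → B k n ≈ explicitBernstein k n
  modifiedBernstein≈explicitBernstein B isB k n = ≈-trans {B k n} {fromℚ (ι (n !)) * egf (B k) n} {explicitBernstein k n}
    (eventually-≡⇒≈ {B k n} {fromℚ (ι (n !)) * egf (B k) n} 0 λ m _ → sym
      (trans (solve 3 (λ f b w → f :* (b :* w) := (f :* w) :* b) refl (ι (n !)) (seq (B k n) m) (1/!ℚ n))
        (trans (cong (ℚ._* seq (B k n) m) (!*1/! n)) (ℚₚ.*-identityˡ _))))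
    (*-congˡ (fromℚ (ι (n !))) {egf (B k) n} {bernsteinGF q 0<q q<1 x k n}
      (≈-sym {bernsteinGF q 0<q q<1 x k n} {egf (B k) n} (isB k n)))

  seq-explicitBernstein : ∀ {k n} → k ℕ.≤ n → ∀ m →
    seq (explicitBernstein k n) m ≡ ι (n !) ℚ.* (expTermℚ (X m) k ℚ.* expTermℚ (Y m) (n ∸ k))
  seq-explicitBernstein {k} {n} k≤n m = cong (ι (n !) ℚ.*_) (seq-bernsteinGF k≤n m)

-- Division by the power of the q-number sum

inv-*-cancel : ∀ d (d#0 : d # 0ℝ) {y z} → (∀ m → seq y m ≡ seq d m ℚ.* seq z m) → inv d d#0 * y ≈ z
inv-*-cancel d d#0 {y} {z} h = let δ , 0<δ , N , away = #⇒away d d#0 in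
  -- From index `N` on the approximations of d are bounded away from 0, so `invℚ` is a true inverse
  -- there.
  eventually-≡⇒≈ {inv d d#0 * y} {z} N λ m p →
    trans (cong (invℚ (seq d m) ℚ.*_) (h m))
      (trans (sym (ℚₚ.*-assoc (invℚ (seq d m)) (seq d m) (seq z m)))
        (trans (cong (ℚ._* seq z m)
            (invℚ-inverse (seq d m) λ e → ℚₚ.<⇒≢ (ℚₚ.<-≤-trans 0<δ (away m p)) (sym (cong ℚ.∣_∣ e))))
          (ℚₚ.*-identityˡ (seq z m))))

theorem7 :
    (q : ℝ) (0<q : 0ℝ < q) (q<1 : q < 1ℝ)
    (n i : ℕ) (1≤i : 1 ℕ.≤ i) (i≤n : i ℕ.≤ n)
    (x : ℝ) (0≤x : 0ℝ ≤ x) (x≤1 : x ≤ 1ℝ)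
    (B : ℕ → ℕ → ℝ) (isB : IsModifiedBernstein q 0<q q<1 x B) →
    let [_] = qNumber q 0<q q<1
        denominator = ([ 1ℝ - x ] + [ x ]) ^ (n ∸ i)
    in
    Σ[ nz ∈ denominator # 0ℝ ]
      inv denominator nz * ∑[ i ∸ 1 ⋯ n ] (λ k → binomialRatio k n i i≤n * B k n) ≈ [ x ] ^ i
theorem7 q 0<q q<1 n i 1≤i i≤n x 0≤x x≤1 B isB = nz ,
  ≈-trans {inv d nz * S B} {inv d nz * S B′} {X ^ i}
    -- `B` is replaced by the explicit polynomials up to `≈`; the remaining step compares
    -- approximations index by index.
    (*-congˡ (inv d nz) {S B} {S B′} (sum-cong (suc n ∸ (i ∸ 1)) λ j → let k = (i ∸ 1) ℕ.+ j in
      *-congˡ (binomialRatio k n i i≤n) {B k n} {B′ k n} (modifiedBernstein≈explicitBernstein q 0<q q<1 x B isB k n)))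
    (inv-*-cancel d nz {S B′} {X ^ i} λ m → trans (seq-bernstein-sum (λ k → B′ k n) (seq X m) (seq Y m) n i 1≤i i≤n m λ k k≤n → seq-explicitBernstein q 0<q q<1 x k≤n m)
      (cong₂ ℚ._*_
        (trans (cong (_^ℚ (n ∸ i)) (ℚₚ.+-comm (seq X m) (seq Y m))) (sym (seq-^ (Y + X) (n ∸ i) m)))
        (sym (seq-^ X i m))))
  where
  X Y d : ℝ
  X = qNumber q 0<q q<1 x
  Y = qNumber q 0<q q<1 (1ℝ - x)
  d = (Y + X) ^ (n ∸ i)
  nz : d # 0ℝ
  nz = ^-#0 (Y + X) (n ∸ i) (qNumber-sum-positive q 0<q q<1 x 0≤x x≤1)
  B′ : ℕ → ℕ → ℝ
  B′ = explicitBernstein q 0<q q<1 x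
  S : (ℕ → ℕ → ℝ) → ℝ
  S b = ∑[ i ∸ 1 ⋯ n ] (λ k → binomialRatio k n i i≤n * b k n)
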